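{- The problem minLength, restricted to instances consisting of $n$ tiles that all have the same tile type of length $\ell$ (only one distinct tile), is solvable in $O(n^2\,2^{\ell}\,\ell\log\ell)$ time. In particular, this restricted problem is fixed-parameter tractable in $\ell$, and it is polynomial-time solvable if $\ell=O(\log n)$.
   Context: minLength: the input is $n$ tiles $S_1,\dots,S_n$, where $S_i\in i\{\star,i\}^{\ell_i}i$ is a string over the two symbols $\star$ (wildcard) and $i$ (numeral) that starts and ends with $i$, and an integer $\rho\ge 0$. The task is to decide whether there is a string (placement) $S[1..\rho]$ over $\{\star\}\cup[1..n]$ such that each $S_i$ has a match at some position $p_i\ge 1$ of $S$, i.e. $p_i+|S_i|-1\le\rho$ and $S[p_i+j-1]=i$ for every $j$ with $S_i[j]=i$. (In the optimization form one computes the minimum such $\rho$.) Two tiles $X,Y$ have the same tile type if they have the same length and, for every $j$, $X[j]$ and $Y[j]$ are either both numerals or both the wildcard. -}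

module Defs where

open import Data.Bool.Base using (if_then_else_)
open import Data.Fin.Base using (Fin; toℕ; inject≤; _↑ʳ_)
open import Data.List.Base
  using (List; []; _∷_; _++_; [_]; length; lookup; map; sum; concat; tabulate)
open import Data.List.Relation.Binary.Pointwise.Base using (Pointwise)
open import Data.List.Relation.Unary.All using (All)
open import Data.Nat.Base using (ℕ; zero; suc; _+_; _*_; _∸_; _^_; _≤_; NonZero)
open import Data.Nat.Logarithm using (⌊log₂_⌋)
open import Data.Nat.Properties using (_≟_)
open import Data.Product.Base using (Σ; ∃; _×_; _,_; proj₁; proj₂)
open import Data.Sum.Base using (_⊎_)
open import Data.Vec.Base as Vec using (Vec)
open import Relation.Binary.PropositionalEquality.Core using (_≡_; _≢_)
open import Relation.Nullary.Decidable.Core using (does)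
open import Relation.Nullary.Negation.Core using (¬_)

-- Unit-cost RAM with addition and (truncated) subtraction as its only
-- arithmetic, as in Cook and Reckhow, so that its polynomial time is the
-- usual one. Programs are structured instead of using jumps, which changes
-- running times by a constant factor only. A program mentions finitely many
-- registers; unbounded storage is available only through load and store.

Reg : Set
Reg = ℕ

infixr 5 _⨾_

data Program : Set where
  skip     : Program
  const    : Reg → ℕ → Program
  add sub  : Reg → Reg → Reg → Program
  load     : Reg → Reg → Program  -- load r s   :  r ← mem[s]
  store    : Reg → Reg → Program  -- store r s  :  mem[r] ← s
  _⨾_      : Program → Program → Program
  ifNZ     : Reg → Program → Program → Program
  whileNZ  : Reg → Program → Program

record State : Set where
  constructor ⟪_,_⟫
  field
    reg : Reg → ℕ
    mem : ℕ → ℕ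

open State public

_[_↦_] : (ℕ → ℕ) → ℕ → ℕ → (ℕ → ℕ)
(f [ k ↦ v ]) x = if does (x ≟ k) then v else f x

setReg : State → Reg → ℕ → State
setReg σ r v = ⟪ reg σ [ r ↦ v ] , mem σ ⟫

setMem : State → ℕ → ℕ → State
setMem σ a v = ⟪ reg σ , mem σ [ a ↦ v ] ⟫

-- Run P σ t τ : started in σ, program P halts in τ after t steps.

data Run : Program → State → ℕ → State → Set where
  run-skip  : ∀ {σ} → Run skip σ 1 σ
  run-const : ∀ {σ r c} → Run (const r c) σ 1 (setReg σ r c)
  run-add   : ∀ {σ r s₁ s₂} →
              Run (add r s₁ s₂) σ 1 (setReg σ r (reg σ s₁ + reg σ s₂))
  run-sub   : ∀ {σ r s₁ s₂} →
              Run (sub r s₁ s₂) σ 1 (setReg σ r (reg σ s₁ ∸ reg σ s₂))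
  run-load  : ∀ {σ r s} → Run (load r s) σ 1 (setReg σ r (mem σ (reg σ s)))
  run-store : ∀ {σ r s} → Run (store r s) σ 1 (setMem σ (reg σ r) (reg σ s))
  run-⨾     : ∀ {P Q σ τ υ t u} →
              Run P σ t τ → Run Q τ u υ → Run (P ⨾ Q) σ (t + u) υ
  run-then  : ∀ {P Q r σ τ t} → reg σ r ≢ 0 →
              Run P σ t τ → Run (ifNZ r P Q) σ (suc t) τ
  run-else  : ∀ {P Q r σ τ t} → reg σ r ≡ 0 →
              Run Q σ t τ → Run (ifNZ r P Q) σ (suc t) τ
  run-exit  : ∀ {P r σ} → reg σ r ≡ 0 → Run (whileNZ r P) σ 1 σ
  run-loop  : ∀ {P r σ τ υ t u} → reg σ r ≢ 0 →
              Run P σ t τ → Run (whileNZ r P) τ u υ →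
              Run (whileNZ r P) σ (suc (t + u)) υ

-- The input occupies memory cells 0, 1, 2, …; all else is initially 0.

cell : List ℕ → ℕ → ℕ
cell []       _       = 0
cell (w ∷ ws) zero    = w
cell (w ∷ ws) (suc a) = cell ws a

initial : List ℕ → State
initial ws = ⟪ (λ _ → 0) , cell ws ⟫

output : State → ℕ
output σ = reg σ 0

Computable : (ℕ → ℕ) → Set
Computable f = Σ Program λ P → ∀ k →
  ∃ λ t → Σ State λ τ → Run P (initial [ k ]) t τ × output τ ≡ f k

record DecisionProblem : Set₁ where
  field
    Instance : Set
    encode   : Instance → List ℕ
    Yes      : Instance → Set

open DecisionProblem public

restrict : (X : DecisionProblem) → (Instance X → Set) → DecisionProblem
restrict X C = record
  { Instance = Σ (Instance X) C
  ; encode   = λ x → encode X (proj₁ x)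
  ; Yes      = λ x → Yes X (proj₁ x)
  }

-- suc ⌊log₂ w ⌋ is the number of binary digits of w (one digit for w = 0).

size : (X : DecisionProblem) → Instance X → ℕ
size X x = sum (map (λ w → suc ⌊log₂ w ⌋) (encode X x))

DecidesWithin : Program → (X : DecisionProblem) → Instance X → ℕ → Set
DecidesWithin P X x T = ∃ λ t → Σ State λ τ →
  Run P (initial (encode X x)) t τ × t ≤ T ×
  ((output τ ≡ 1 × Yes X x) ⊎ (output τ ≡ 0 × ¬ Yes X x))

SolvableWithin : (X : DecisionProblem) → (Instance X → ℕ) → Set
SolvableWithin X T = Σ Program λ P → ∀ x → DecidesWithin P X x (T x)

SolvableInO : (X : DecisionProblem) → (Instance X → ℕ) → Set
SolvableInO X g = ∃ λ c → SolvableWithin X (λ x → c * g x)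

PolynomialTime : DecisionProblem → Set
PolynomialTime X = ∃ λ k → SolvableInO X (λ x → size X x ^ k)

FixedParameterTractable : (X : DecisionProblem) → (Instance X → ℕ) → Set
FixedParameterTractable X κ = Σ (ℕ → ℕ) λ f → Computable f ×
  ∃ λ k → SolvableWithin X (λ x → f (κ x) * size X x ^ k)

_∈O[_] : (ℕ → ℕ) → (ℕ → ℕ) → Set
f ∈O[ g ] = ∃ λ c → ∃ λ n₀ → ∀ n → n₀ ≤ n → f n ≤ c * g n

-- The numerals 1, …, n are the elements of Fin n.

data Symbol (n : ℕ) : Set where
  ⋆   : Symbol n
  num : Fin n → Symbol n

String : ℕ → Set
String n = List (Symbol n)

-- S ∈ i {⋆, i}* i

IsTile : ∀ {n} → Fin n → String n → Set
IsTile {n} i S = Σ (String n) λ w →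
  All (λ s → s ≡ ⋆ ⊎ s ≡ num i) w × S ≡ num i ∷ (w ++ [ num i ])

data SameKind {n : ℕ} : Symbol n → Symbol n → Set where
  ⋆-⋆     : SameKind ⋆ ⋆
  num-num : ∀ {i j} → SameKind (num i) (num j)

-- Pointwise forces equal lengths.

SameTileType : ∀ {n} → String n → String n → Set
SameTileType = Pointwise SameKind

-- Positions are counted from 0: a match at offset p is a match at
-- position p + 1 of the 1-based convention.

MatchesAt : ∀ {n ρ} → Vec (Symbol n) ρ → Fin n → String n → ℕ → Set
MatchesAt {ρ = ρ} S i X p = Σ (p + length X ≤ ρ) λ fits →
  ∀ (j : Fin (length X)) → lookup X j ≡ num i →
  Vec.lookup S (inject≤ (p ↑ʳ j) fits) ≡ num i

record Tiling : Set where
  field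
    n      : ℕ
    ρ      : ℕ
    tile   : Fin n → String n
    isTile : ∀ i → IsTile i (tile i)

open Tiling public

HasPlacement : Tiling → Set
HasPlacement I = Σ (Vec (Symbol (n I)) (ρ I)) λ S →
  ∀ i → ∃ λ p → MatchesAt S i (tile I i) p

encodeSymbol : ∀ {n} → Symbol n → ℕ
encodeSymbol ⋆       = 0
encodeSymbol (num i) = suc (toℕ i)

-- n, ρ, |S₁|, S₁, …, |Sₙ|, Sₙ

encodeTiling : Tiling → List ℕ
encodeTiling I = n I ∷ ρ I ∷
  concat (tabulate λ i → length (tile I i) ∷ map encodeSymbol (tile I i))

minLength : DecisionProblem
minLength = record
  { Instance = Tiling
  ; encode   = encodeTiling
  ; Yes      = HasPlacement
  }

-- There is exactly one tile type, and it has length ℓ; in particular there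
-- is at least one tile, so that ℓ is determined by the instance.

record OneTileType (I : Tiling) : Set where
  field
    ℓ         : ℕ
    nonEmpty  : NonZero (n I)
    hasLength : ∀ i → length (tile I i) ≡ ℓ
    sameType  : ∀ i j → SameTileType (tile I i) (tile I j)

minLength₁ : DecisionProblem
minLength₁ = restrict minLength OneTileType

tileCount : Instance minLength₁ → ℕ
tileCount (I , _) = n I

tileLength : Instance minLength₁ → ℕ
tileLength (_ , u) = OneTileType.ℓ u

{-# OPTIONS --safe #-}

-- All tiles are translates of one mask of numerals, and matches of different
-- tiles may not share a numeral cell; so the question is whether n pairwise
-- disjoint translates of the mask fit into [0, ρ). If n ℓ ≤ ρ, lay the tiles end
-- to end. Otherwise scan the ρ + 1 - ℓ ≤ n ℓ possible starting points from left to
-- right, remembering which of the next ℓ cells are occupied as a binary number w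
-- (bit 0 is the current cell). With k starting points left, the maximal number of
-- tiles that still fit is
--   best (k+1) w = max (best k ⌊w/2⌋) (1 + best k ⌊(w + mask)/2⌋),
-- the second option being present only if w and the mask are disjoint. Tables of
-- ⌊w/2⌋ and of the disjointness test make each entry a constant number of RAM
-- steps, for a total of O(n ℓ 2^ℓ).

module Submission where

open import Defs
open import Data.Bool.Base using (if_then_else_)
open import Data.Empty using (⊥)
open import Data.Fin.Base using (Fin; zero; suc; toℕ; fromℕ<; inject≤; punchIn; _↑ʳ_)
open import Data.Fin.Properties
  using (any?; toℕ<n; toℕ-injective; toℕ-fromℕ<; toℕ-inject≤; toℕ-↑ʳ;
         punchInᵢ≢i; punchIn-injective; inject≤-injective)
import Data.Fin.Properties as Fin
open import Data.List.Base
  using (List; []; _∷_; [_]; _++_; length; map; lookup; concat; tabulate)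
open import Data.List.Properties using (length-map; length-++)
open import Data.List.Relation.Binary.Pointwise.Base using ([]; _∷_)
open import Data.List.Relation.Unary.All using (All; []; _∷_)
open import Data.List.Relation.Unary.All.Properties using (++⁺)
open import Data.Nat.Base
open import Data.Nat.Induction using (<-rec)
open import Data.Nat.ListAction using (sum)
open import Data.Nat.Logarithm
  using (⌊log₂_⌋; ⌊log₂⌋-mono-≤; ⌊log₂⌊n/2⌋⌋≡⌊log₂n⌋∸1; ⌊log₂[2^n]⌋≡n)
open import Data.Nat.Properties
open import Data.Product.Base using (Σ; ∃; _×_; _,_; proj₁; proj₂)
open import Data.Sum.Base using (_⊎_; inj₁; inj₂) renaming (map to map-⊎)
import Data.Vec.Base as Vec
import Data.Vec.Properties as Vec
open import Function.Base using (_∘_)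
open import Relation.Binary.Definitions using (tri<; tri≈; tri>)
open import Relation.Binary.PropositionalEquality hiding ([_])
open import Relation.Nullary using (¬_; Dec; yes; no; contradiction)
open import Relation.Nullary.Decidable using (_×-dec_; ¬?; dec-true; dec-false)

-- Windows and packings

odd : ℕ → ℕ
odd 0             = 0
odd 1             = 1
odd (suc (suc w)) = odd w

bit : ℕ → ℕ → ℕ
bit w zero    = odd w
bit w (suc j) = bit ⌊ w /2⌋ j

mask : List ℕ → ℕ
mask []           = 0
mask (zero  ∷ cs) = mask cs + mask cs
mask (suc _ ∷ cs) = suc (mask cs + mask cs)

-- The flag `ok` starts at 1; a set bit under a numeral takes it to 0, and truncated subtraction
-- keeps it there. It is an accumulator so that the recursion follows the program's scan symbol by
-- symbol.
free : ℕ → List ℕ → ℕ → ℕ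
free ok []           w = ok
free ok (zero  ∷ cs) w = free ok cs ⌊ w /2⌋
free ok (suc _ ∷ cs) w = free (ok ∸ odd w) cs ⌊ w /2⌋

choose : ℕ → ℕ → ℕ → ℕ
choose zero    x y = x
choose (suc _) x y = x ⊔ suc y

best : List ℕ → ℕ → ℕ → ℕ
best cs zero    w = 0
best cs (suc k) w =
  choose (free 1 cs w) (best cs k ⌊ w /2⌋) (best cs k ⌊ w + mask cs /2⌋)

odd+half : ∀ w → w ≡ odd w + (⌊ w /2⌋ + ⌊ w /2⌋)
odd+half 0             = refl
odd+half 1             = refl
odd+half (suc (suc w)) = begin
  suc (suc w)                                  ≡⟨ cong (2 +_) (odd+half w) ⟩
  suc (suc (odd w + (⌊ w /2⌋ + ⌊ w /2⌋)))      ≡⟨ cong suc (+-suc (odd w) _) ⟨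
  suc (odd w + suc (⌊ w /2⌋ + ⌊ w /2⌋))        ≡⟨ +-suc (odd w) _ ⟨
  odd w + suc (suc (⌊ w /2⌋ + ⌊ w /2⌋))        ≡⟨ cong (λ x → odd w + suc x) (+-suc ⌊ w /2⌋ ⌊ w /2⌋) ⟨
  odd w + (suc ⌊ w /2⌋ + suc ⌊ w /2⌋)          ∎
  where open ≡-Reasoning

-- The machine has no parity test: `useCell` obtains the lowest bit by subtracting the tabulated
-- half twice.
odd-by-halving : ∀ w → w ∸ ⌊ w /2⌋ ∸ ⌊ w /2⌋ ≡ odd w
odd-by-halving w = begin
  w ∸ h ∸ h               ≡⟨ ∸-+-assoc w h h ⟩
  w ∸ (h + h)             ≡⟨ cong (_∸ (h + h)) (odd+half w) ⟩
  odd w + (h + h) ∸ (h + h) ≡⟨ m+n∸n≡m (odd w) (h + h) ⟩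
  odd w                   ∎
  where
  open ≡-Reasoning
  h = ⌊ w /2⌋

odd-0-or-1 : ∀ w → odd w ≡ 0 ⊎ odd w ≡ 1
odd-0-or-1 0             = inj₁ refl
odd-0-or-1 1             = inj₂ refl
odd-0-or-1 (suc (suc w)) = odd-0-or-1 w

odd-+-double : ∀ w m → odd (w + (m + m)) ≡ odd w
odd-+-double w zero    = cong odd (+-identityʳ w)
odd-+-double w (suc m)
  rewrite +-suc m m | +-suc w (suc (m + m)) | +-suc w (m + m) = odd-+-double w m

half-+-double : ∀ w m → ⌊ w + (m + m) /2⌋ ≡ ⌊ w /2⌋ + m
half-+-double w zero    = trans (cong ⌊_/2⌋ (+-identityʳ w)) (sym (+-identityʳ _))
half-+-double w (suc m)
  rewrite +-suc m m | +-suc w (suc (m + m)) | +-suc w (m + m) | +-suc ⌊ w /2⌋ m =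
  cong suc (half-+-double w m)

odd-suc-even : ∀ w → odd w ≡ 0 → odd (suc w) ≡ 1
odd-suc-even 0             _  = refl
odd-suc-even (suc (suc w)) eq = odd-suc-even w eq

half-suc-even : ∀ w → odd w ≡ 0 → ⌊ suc w /2⌋ ≡ ⌊ w /2⌋
half-suc-even 0             _  = refl
half-suc-even (suc (suc w)) eq = cong suc (half-suc-even w eq)

odd-even+1+double : ∀ w m → odd w ≡ 0 → odd (w + suc (m + m)) ≡ 1
odd-even+1+double w m e = begin
  odd (w + suc (m + m))  ≡⟨ cong odd (+-suc w (m + m)) ⟩
  odd (suc w + (m + m))  ≡⟨ odd-+-double (suc w) m ⟩
  odd (suc w)            ≡⟨ odd-suc-even w e ⟩
  1                      ∎
  where open ≡-Reasoning

-- An odd number added to an even one produces no carry out of the lowest bit.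
half-even+1+double : ∀ w m → odd w ≡ 0 → ⌊ w + suc (m + m) /2⌋ ≡ ⌊ w /2⌋ + m
half-even+1+double w m e = begin
  ⌊ w + suc (m + m) /2⌋  ≡⟨ cong ⌊_/2⌋ (+-suc w (m + m)) ⟩
  ⌊ suc w + (m + m) /2⌋  ≡⟨ half-+-double (suc w) m ⟩
  ⌊ suc w /2⌋ + m        ≡⟨ cong (_+ m) (half-suc-even w e) ⟩
  ⌊ w /2⌋ + m            ∎
  where open ≡-Reasoning

bit-0 : ∀ j → bit 0 j ≡ 0
bit-0 zero    = refl
bit-0 (suc j) = bit-0 j

Disjoint : List ℕ → ℕ → Set
Disjoint cs w = ∀ j → cell cs j ≢ 0 → bit w j ≡ 0

free-0 : ∀ cs w → free 0 cs w ≡ 0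
free-0 []           w = refl
free-0 (zero  ∷ cs) w = free-0 cs ⌊ w /2⌋
free-0 (suc _ ∷ cs) w rewrite 0∸n≡0 (odd w) = free-0 cs ⌊ w /2⌋

free-complete : ∀ cs w → Disjoint cs w → free 1 cs w ≡ 1
free-complete []           w d = refl
free-complete (zero  ∷ cs) w d = free-complete cs ⌊ w /2⌋ (d ∘ suc)
free-complete (suc _ ∷ cs) w d rewrite d 0 (λ ()) = free-complete cs ⌊ w /2⌋ (d ∘ suc)

free-sound : ∀ cs w → free 1 cs w ≢ 0 → Disjoint cs w
free-sound []           w f j       c = contradiction refl c
free-sound (zero  ∷ cs) w f zero    c = contradiction refl c
free-sound (zero  ∷ cs) w f (suc j) c = free-sound cs ⌊ w /2⌋ f j c
free-sound (suc _ ∷ cs) w f j c with odd-0-or-1 w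
free-sound (suc _ ∷ cs) w f zero    c | inj₁ eq = eq
free-sound (suc _ ∷ cs) w f (suc j) c | inj₁ eq rewrite eq = free-sound cs ⌊ w /2⌋ f j c
... | inj₂ eq rewrite eq = contradiction (free-0 cs ⌊ w /2⌋) f

free-0-or-1 : ∀ cs w → free 1 cs w ≡ 0 ⊎ free 1 cs w ≡ 1
free-0-or-1 cs w with free 1 cs w ≟ 0
... | yes eq = inj₁ eq
... | no ¬eq = inj₂ (free-complete cs w (free-sound cs w ¬eq))

best-1 : ∀ cs w → best cs 1 w ≡ free 1 cs w
best-1 cs w with free-0-or-1 cs w
... | inj₁ eq rewrite eq = refl
... | inj₂ eq rewrite eq = refl

-- Where no bit is set in both, the addition never carries, so `w + mask cs` is the bitwise union.
-- This direction and the next say so in terms of clear bits.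
bit-+-mask⁻ : ∀ cs w → Disjoint cs w → ∀ j →
              bit (w + mask cs) j ≡ 0 → bit w j ≡ 0 × cell cs j ≡ 0
bit-+-mask⁻ [] w d j b = trans (cong (λ x → bit x j) (sym (+-identityʳ w))) b , refl
bit-+-mask⁻ (zero ∷ cs) w d zero b = trans (sym (odd-+-double w (mask cs))) b , refl
bit-+-mask⁻ (zero ∷ cs) w d (suc j) b rewrite half-+-double w (mask cs) =
  bit-+-mask⁻ cs ⌊ w /2⌋ (d ∘ suc) j b
bit-+-mask⁻ (suc _ ∷ cs) w d zero b =
  contradiction (trans (sym (odd-even+1+double w (mask cs) (d 0 λ ()))) b) λ ()
bit-+-mask⁻ (suc _ ∷ cs) w d (suc j) b =
  bit-+-mask⁻ cs ⌊ w /2⌋ (d ∘ suc) j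
    (subst (λ x → bit x j ≡ 0) (half-even+1+double w (mask cs) (d 0 λ ())) b)

bit-+-mask⁺ : ∀ cs w → Disjoint cs w → ∀ j →
              bit w j ≡ 0 → cell cs j ≡ 0 → bit (w + mask cs) j ≡ 0
bit-+-mask⁺ [] w d j b _ = trans (cong (λ x → bit x j) (+-identityʳ w)) b
bit-+-mask⁺ (zero ∷ cs) w d zero b _ = trans (odd-+-double w (mask cs)) b
bit-+-mask⁺ (zero ∷ cs) w d (suc j) b c rewrite half-+-double w (mask cs) =
  bit-+-mask⁺ cs ⌊ w /2⌋ (d ∘ suc) j b c
bit-+-mask⁺ (suc _ ∷ cs) w d zero    b c = contradiction c λ ()
bit-+-mask⁺ (suc _ ∷ cs) w d (suc j) b c =
  subst (λ x → bit x j ≡ 0) (sym (half-even+1+double w (mask cs) (d 0 λ ())))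
    (bit-+-mask⁺ cs ⌊ w /2⌋ (d ∘ suc) j b c)

-- Keeps look-ups inside the tables: with `p` the number of windows, moving on by one cell leads
-- from `w` or `w + mask cs` to a window below `p`.
half-< : ∀ {w p} → w < p + p → ⌊ w /2⌋ < p
half-< {w} {p} w<2p = ≰⇒> λ p≤h → <⇒≱ w<2p (begin
  p + p                        ≤⟨ +-mono-≤ p≤h p≤h ⟩
  ⌊ w /2⌋ + ⌊ w /2⌋            ≤⟨ m≤n+m _ (odd w) ⟩
  odd w + (⌊ w /2⌋ + ⌊ w /2⌋)  ≡⟨ odd+half w ⟨
  w                            ∎)
  where open ≤-Reasoning

suc-+-suc-≤ : ∀ {m n} → m < n → suc (suc (m + m)) ≤ n + n
suc-+-suc-≤ {m} {n} m<n = subst (_≤ n + n) (cong suc (+-suc m m)) (+-mono-≤ m<n m<n)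

2^suc : ∀ k → 2 ^ suc k ≡ 2 ^ k + 2 ^ k
2^suc k = cong (2 ^ k +_) (+-identityʳ (2 ^ k))

mask-< : ∀ cs → mask cs < 2 ^ length cs
mask-< []           = s≤s z≤n
mask-< (zero  ∷ cs) rewrite 2^suc (length cs) = +-mono-< (mask-< cs) (mask-< cs)
mask-< (suc _ ∷ cs) rewrite 2^suc (length cs) = suc-+-suc-≤ (mask-< cs)

-- Starts are relative to the current cell, which is bit 0 of the window `w`; `k` is the number of
-- starting points left and `c` the number of translates.
record Packing (cs : List ℕ) (k w c : ℕ) : Set where
  field
    start    : Fin c → ℕ
    inRange  : ∀ i → start i < k
    avoids   : ∀ i j → cell cs j ≢ 0 → bit w (start i + j) ≡ 0
    disjoint : ∀ {i i′} → i ≢ i′ → ∀ j j′ → cell cs j ≢ 0 → cell cs j′ ≢ 0 →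
               start i + j ≢ start i′ + j′

open Packing

-- The machine adds and subtracts but has no maximum; `placeTile` computes it in this form.
m⊔n≡m+[n∸m] : ∀ m n → m ⊔ n ≡ m + (n ∸ m)
m⊔n≡m+[n∸m] zero    n       = refl
m⊔n≡m+[n∸m] (suc m) zero    = cong suc (sym (+-identityʳ m))
m⊔n≡m+[n∸m] (suc m) (suc n) = cong suc (m⊔n≡m+[n∸m] m n)

choose-≥ : ∀ f x y → x ≤ choose f x y
choose-≥ zero    x y = ≤-refl
choose-≥ (suc _) x y = m≤m⊔n x (suc y)

-- Induction on the starting points. If no translate starts at the current cell, all of them shift
-- down by one. Otherwise the one that starts there is removed and its numerals are recorded in the
-- window.
packing⇒≤best : ∀ cs → cell cs 0 ≢ 0 → ∀ k w c → Packing cs k w c → c ≤ best cs k w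
packing⇒≤best cs hd zero    w zero    p = z≤n
packing⇒≤best cs hd zero    w (suc c) p = contradiction (inRange p zero) (λ ())
packing⇒≤best cs hd (suc k) w c p with any? (λ i → start p i ≟ 0)
... | no none = ≤-trans
  (packing⇒≤best cs hd k ⌊ w /2⌋ c shifted) (choose-≥ (free 1 cs w) _ _)
  where
  positive : ∀ i → start p i ≡ suc (pred (start p i))
  positive i = sym (suc-pred (start p i) ⦃ ≢-nonZero λ eq → none (i , eq) ⦄)
  shifted : Packing cs k ⌊ w /2⌋ c
  shifted .start i = pred (start p i)
  shifted .inRange i = s≤s⁻¹ (subst (_< suc k) (positive i) (inRange p i))
  shifted .avoids i j f = subst (λ s → bit w (s + j) ≡ 0) (positive i) (avoids p i j f)
  shifted .disjoint i≢i′ j j′ f f′ eq = disjoint p i≢i′ j j′ f f′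
    (trans (cong (_+ j) (positive _)) (trans (cong suc eq) (cong (_+ j′) (sym (positive _)))))
packing⇒≤best cs hd (suc k) w (suc c) p | yes (i₀ , at0) = begin
  suc c                                                    ≤⟨ s≤s (packing⇒≤best cs hd k _ c rest) ⟩
  suc (best cs k ⌊ w + mask cs /2⌋)                        ≤⟨ m≤n⊔m (best cs k ⌊ w /2⌋) _ ⟩
  choose 1 (best cs k ⌊ w /2⌋) (best cs k ⌊ w + mask cs /2⌋) ≡⟨ cong (λ f → choose f (best cs k ⌊ w /2⌋) (best cs k ⌊ w + mask cs /2⌋)) (free-complete cs w room) ⟨
  best cs (suc k) w                                        ∎
  where
  open ≤-Reasoning hiding (start)
  room : Disjoint cs w
  room j f = subst (λ s → bit w (s + j) ≡ 0) at0 (avoids p i₀ j f)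
  other : Fin c → ℕ
  other i = start p (punchIn i₀ i)
  positive : ∀ i → other i ≡ suc (pred (other i))
  -- Tiles begin with a numeral (`hd`), so a second translate starting at 0 would share its first
  -- cell with `i₀`.
  positive i = sym (suc-pred (other i) ⦃ ≢-nonZero (λ eq →
    disjoint p (punchInᵢ≢i i₀ i) 0 0 hd hd (cong (_+ 0) (trans eq (sym at0)))) ⦄)
  rest : Packing cs k ⌊ w + mask cs /2⌋ c
  rest .start i = pred (other i)
  rest .inRange i = s≤s⁻¹ (subst (_< suc k) (positive i) (inRange p _))
  rest .avoids i j f = subst (λ s → bit (w + mask cs) (s + j) ≡ 0) (positive i)
    (bit-+-mask⁺ cs w room (other i + j) (avoids p _ j f) (uncovered (other i + j) refl))
    where
    -- A numeral of `i₀` at this offset would share its cell with the numeral at offset `j` of the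
    -- other translate.
    uncovered : ∀ x → x ≡ other i + j → cell cs x ≡ 0
    uncovered x eq with cell cs x ≟ 0
    ... | yes e = e
    ... | no ¬e = contradiction
      (trans (sym eq) (cong (_+ x) (sym at0)))
      (disjoint p (punchInᵢ≢i i₀ i) j x f ¬e)
  rest .disjoint {i} {i′} i≢i′ j j′ f f′ eq = disjoint p (i≢i′ ∘ punchIn-injective i₀ i i′) j j′ f f′
    (trans (cong (_+ j) (positive i)) (trans (cong suc eq) (cong (_+ j′) (sym (positive i′)))))

skip-one : ∀ {cs k w c} → Packing cs k ⌊ w /2⌋ c → Packing cs (suc k) w c
skip-one p = record
  { start    = suc ∘ start p
  ; inRange  = s≤s ∘ inRange p
  ; avoids   = avoids p
  ; disjoint = λ i≢i′ j j′ f f′ → disjoint p i≢i′ j j′ f f′ ∘ suc-injective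
  }

-- Clearness in the enlarged window splits by `bit-+-mask⁻`: the part about `w` gives `avoids`, the
-- part about `cs` gives disjointness from the new translate at 0.
place-one : ∀ {cs k w c} → Disjoint cs w →
            Packing cs k ⌊ w + mask cs /2⌋ c → Packing cs (suc k) w (suc c)
place-one {cs} {k} {w} {c} room p = record
  { start = start′ ; inRange = inRange′ ; avoids = avoids′ ; disjoint = disjoint′ _ _ }
  where
  start′ : Fin (suc c) → ℕ
  start′ zero    = 0
  start′ (suc i) = suc (start p i)
  inRange′ : ∀ i → start′ i < suc k
  inRange′ zero    = s≤s z≤n
  inRange′ (suc i) = s≤s (inRange p i)
  clear : ∀ i j → cell cs j ≢ 0 →
          bit w (suc (start p i) + j) ≡ 0 × cell cs (suc (start p i) + j) ≡ 0
  clear i j f = bit-+-mask⁻ cs w room (suc (start p i) + j) (avoids p i j f)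
  avoids′ : ∀ i j → cell cs j ≢ 0 → bit w (start′ i + j) ≡ 0
  avoids′ zero    j f = room j f
  avoids′ (suc i) j f = proj₁ (clear i j f)
  disjoint′ : ∀ i i′ → i ≢ i′ → ∀ j j′ → cell cs j ≢ 0 → cell cs j′ ≢ 0 →
              start′ i + j ≢ start′ i′ + j′
  disjoint′ zero    zero     i≢i′ j j′ f f′ eq = i≢i′ refl
  disjoint′ zero    (suc i′) i≢i′ j j′ f f′ eq =
    f (trans (cong (cell cs) eq) (proj₂ (clear i′ j′ f′)))
  disjoint′ (suc i) zero     i≢i′ j j′ f f′ eq =
    f′ (trans (cong (cell cs) (sym eq)) (proj₂ (clear i j f)))
  disjoint′ (suc i) (suc i′) i≢i′ j j′ f f′ eq =
    disjoint p (i≢i′ ∘ cong suc) j j′ f f′ (suc-injective eq)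

-- A maximum equals one of its two arguments, and either option extends a packing of the remaining
-- starting points.
best-packing : ∀ cs k w → Packing cs k w (best cs k w)
best-packing cs zero w = record
  { start = λ () ; inRange = λ () ; avoids = λ () ; disjoint = λ { {()} } }
best-packing cs (suc k) w with free 1 cs w in eq
... | zero = skip-one (best-packing cs k ⌊ w /2⌋)
... | suc _ with ⊔-sel (best cs k ⌊ w /2⌋) (suc (best cs k ⌊ w + mask cs /2⌋))
...   | inj₁ e = subst (Packing cs (suc k) w) (sym e) (skip-one (best-packing cs k ⌊ w /2⌋))
...   | inj₂ e = subst (Packing cs (suc k) w) (sym e) (place-one
  (free-sound cs w λ z → contradiction (trans (sym eq) z) λ ())
  (best-packing cs k ⌊ w + mask cs /2⌋))

restrict-packing : ∀ {cs k w c d} → c ≤ d → Packing cs k w d → Packing cs k w c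
restrict-packing c≤d p = record
  { start    = λ i → start p (inject≤ i c≤d)
  ; inRange  = λ i → inRange p _
  ; avoids   = λ i → avoids p _
  ; disjoint = λ i≢i′ → disjoint p (i≢i′ ∘ inject≤-injective c≤d c≤d _ _)
  }

-- Placements as packings

num-injective : ∀ {n} {i j : Fin n} → num i ≡ num j → i ≡ j
num-injective refl = refl

codes : ∀ {n} → String n → List ℕ
codes = map encodeSymbol

cell-length : ∀ cs {j} → cell cs j ≢ 0 → j < length cs
cell-length []               c = contradiction refl c
cell-length (_ ∷ cs) {zero}  c = s≤s z≤n
cell-length (_ ∷ cs) {suc j} c = s≤s (cell-length cs c)

tile-symbols : ∀ {n} {i : Fin n} {X} → IsTile i X → All (λ s → s ≡ ⋆ ⊎ s ≡ num i) X
tile-symbols (_ , ws , refl) = inj₂ refl ∷ ++⁺ ws (inj₂ refl ∷ [])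

lookup-tile : ∀ {n} {i i′ : Fin n} {X} → All (λ s → s ≡ ⋆ ⊎ s ≡ num i) X →
              ∀ j → lookup X j ≡ num i′ → i′ ≡ i
lookup-tile (inj₁ refl ∷ _)  zero    ()
lookup-tile (inj₂ refl ∷ _)  zero    refl = refl
lookup-tile (_         ∷ ss) (suc j) eq   = lookup-tile ss j eq

filled⇒numeral : ∀ {n} {X₀ X : String n} → SameTileType X₀ X → ∀ j →
                 cell (codes X₀) (toℕ j) ≢ 0 → ∃ λ i → lookup X j ≡ num i
filled⇒numeral (⋆-⋆     ∷ _)  zero    f = contradiction refl f
filled⇒numeral (num-num ∷ _)  zero    f = _ , refl
filled⇒numeral (_       ∷ ks) (suc j) f = filled⇒numeral ks j f

numeral⇒filled : ∀ {n} {X₀ X : String n} {i} → SameTileType X₀ X → ∀ j →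
                 lookup X j ≡ num i → cell (codes X₀) (toℕ j) ≢ 0
numeral⇒filled (num-num ∷ _)  zero    eq ()
numeral⇒filled (_       ∷ ks) (suc j) eq = numeral⇒filled ks j eq

tile-starts-filled : ∀ {n} {i : Fin n} {X} → IsTile i X → cell (codes X) 0 ≢ 0
tile-starts-filled (_ , _ , refl) ()

-- The starts are multiples of the length; numerals sit at offsets below it, so each tile ends
-- before the next multiple. The bound `suc ρ ∸ length cs` counts the starts from which a tile still
-- ends by `ρ`.
consecutive : ∀ cs n {ρ} → n * length cs ≤ ρ → Packing cs (suc ρ ∸ length cs) 0 n
consecutive cs n {ρ} nℓ≤ρ = record
  { start    = λ i → toℕ i * length cs
  ; inRange  = inRange′
  ; avoids   = λ i j _ → bit-0 (toℕ i * length cs + j)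
  ; disjoint = λ {i} {i′} → disjoint′ i i′
  }
  where
  ends : ∀ (i : Fin n) → toℕ i * length cs + length cs ≤ ρ
  ends i = ≤-trans (≤-reflexive (+-comm _ (length cs)))
    (≤-trans (*-monoˡ-≤ (length cs) (toℕ<n i)) nℓ≤ρ)
  inRange′ : ∀ (i : Fin n) → toℕ i * length cs < suc ρ ∸ length cs
  inRange′ i = m+n≤o⇒m≤o∸n _ (s≤s (ends i))
  before : ∀ {a b j j′} → a < b → cell cs j ≢ 0 →
           a * length cs + j ≢ b * length cs + j′
  before {a} {b} {j} {j′} a<b f = <⇒≢ (begin-strict
    a * length cs + j          <⟨ +-monoʳ-< (a * length cs) (cell-length cs f) ⟩
    a * length cs + length cs  ≡⟨ +-comm (a * length cs) (length cs) ⟩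
    suc a * length cs          ≤⟨ *-monoˡ-≤ (length cs) a<b ⟩
    b * length cs              ≤⟨ m≤m+n _ j′ ⟩
    b * length cs + j′         ∎)
    where open ≤-Reasoning
  disjoint′ : ∀ (i i′ : Fin n) → i ≢ i′ → ∀ j j′ → cell cs j ≢ 0 → cell cs j′ ≢ 0 →
              toℕ i * length cs + j ≢ toℕ i′ * length cs + j′
  disjoint′ i i′ i≢i′ j j′ f f′ eq with <-cmp (toℕ i) (toℕ i′)
  ... | tri< i<i′ _ _ = before i<i′ f eq
  ... | tri≈ _ i≡i′ _ = i≢i′ (toℕ-injective i≡i′)
  ... | tri> _ _ i′<i = before i′<i f′ (sym eq)

module _ (I : Tiling) (u : OneTileType I) (i₀ : Fin (n I)) where

  open OneTileType u

  private
    cs : List ℕ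
    cs = codes (tile I i₀)

    length-cs : length cs ≡ ℓ
    length-cs = trans (length-map encodeSymbol (tile I i₀)) (hasLength i₀)

    position : ∀ i {j} → cell cs j ≢ 0 → Fin (length (tile I i))
    position i f = fromℕ< (subst (_ <_) (trans length-cs (sym (hasLength i))) (cell-length cs f))

    toℕ-position : ∀ i {j} (f : cell cs j ≢ 0) → toℕ (position i f) ≡ j
    toℕ-position i f = toℕ-fromℕ< _

    -- The common tile type gives some numeral at this position, and a tile contains no numeral but
    -- its own.
    numeral-at : ∀ i {j} (f : cell cs j ≢ 0) → lookup (tile I i) (position i f) ≡ num i
    numeral-at i {j} f
      with filled⇒numeral (sameType i₀ i) (position i f)
             (subst (λ x → cell cs x ≢ 0) (sym (toℕ-position i f)) f)
    ... | i′ , eq = trans eq (cong num (lookup-tile (tile-symbols (isTile I i)) _ eq))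

  -- A cell shared by two translates would have to hold two different numerals.
  placement⇒packing : HasPlacement I → Packing cs (suc (ρ I) ∸ ℓ) 0 (n I)
  placement⇒packing (S , match) = record
    { start    = λ i → proj₁ (match i)
    ; inRange  = λ i → m+n≤o⇒m≤o∸n _ (s≤s (subst (λ l → proj₁ (match i) + l ≤ ρ I) (hasLength i) (fits i)))
    ; avoids   = λ i j _ → bit-0 (proj₁ (match i) + j)
    ; disjoint = λ i≢i′ j j′ f f′ eq → i≢i′ (num-injective (begin
        num _                       ≡⟨ proj₂ (proj₂ (match _)) _ (numeral-at _ f) ⟨
        Vec.lookup S (index _ f)    ≡⟨ cong (Vec.lookup S) (toℕ-injective
                                         (trans (toℕ-index _ f) (trans eq (sym (toℕ-index _ f′))))) ⟩
        Vec.lookup S (index _ f′)   ≡⟨ proj₂ (proj₂ (match _)) _ (numeral-at _ f′) ⟩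
        num _                       ∎))
    }
    where
    open ≡-Reasoning
    fits : ∀ i → proj₁ (match i) + length (tile I i) ≤ ρ I
    fits i = proj₁ (proj₂ (match i))
    index : ∀ i {j} → cell cs j ≢ 0 → Fin (ρ I)
    index i f = inject≤ (proj₁ (match i) ↑ʳ position i f) (fits i)
    toℕ-index : ∀ i {j} (f : cell cs j ≢ 0) → toℕ (index i f) ≡ proj₁ (match i) + j
    toℕ-index i f = trans (toℕ-inject≤ _ (fits i))
      (trans (toℕ-↑ʳ (proj₁ (match i)) _) (cong (proj₁ (match i) +_) (toℕ-position i f)))

  -- Each cell receives the numeral of a tile covering it, found by search over all tiles, and ⋆ if
  -- there is none. Disjointness makes the covering tile unique, so every tile finds its own
  -- numeral.
  packing⇒placement : Packing cs (suc (ρ I) ∸ ℓ) 0 (n I) → HasPlacement I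
  packing⇒placement p = Vec.tabulate symbol , λ i → start p i , fits i , λ j eq →
    trans (Vec.lookup∘tabulate symbol _)
      (covered⇒symbol i (toℕ j) _ (trans (toℕ-inject≤ _ (fits i)) (toℕ-↑ʳ (start p i) j))
        (numeral⇒filled (sameType i₀ i) j eq))
    where
    fits : ∀ i → start p i + length (tile I i) ≤ ρ I
    fits i = subst (λ l → start p i + l ≤ ρ I) (sym (hasLength i))
      (s≤s⁻¹ (m≤o∸n⇒m+n≤o (suc (start p i))
        -- Undoing the truncated subtraction requires `ℓ ≤ suc (ρ I)`, which holds because a start
        -- below the difference makes the difference nonzero.
        (<⇒≤ (m∸n≢0⇒n<m (>⇒≢ (≤-<-trans z≤n (inRange p i)))))
        (inRange p i)))
    -- The comparison excludes cells before the start, for which truncated subtraction would give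
    -- offset 0, a numeral.
    Covers : Fin (ρ I) → Fin (n I) → Set
    Covers x i = start p i ≤ toℕ x × cell cs (toℕ x ∸ start p i) ≢ 0
    covers? : ∀ x → Dec (∃ (Covers x))
    covers? x = any? λ i → (start p i ≤? toℕ x) ×-dec ¬? (cell cs (toℕ x ∸ start p i) ≟ 0)
    owner : ∀ {x} → Dec (∃ (Covers x)) → Symbol (n I)
    owner (yes (i , _)) = num i
    owner (no _)        = ⋆
    symbol : Fin (ρ I) → Symbol (n I)
    symbol x = owner (covers? x)
    covered⇒symbol : ∀ i j x → toℕ x ≡ start p i + j → cell cs j ≢ 0 → symbol x ≡ num i
    covered⇒symbol i j x eq f with covers? x
    ... | no none = contradiction
      (i , subst (start p i ≤_) (sym eq) (m≤m+n _ j)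
         , subst (λ y → cell cs y ≢ 0) (sym (trans (cong (_∸ start p i) eq) (m+n∸m≡n (start p i) j))) f)
      none
    ... | yes (i′ , le , f′) with i′ Fin.≟ i
    ...   | yes i′≡i = cong num i′≡i
    ...   | no  i′≢i = contradiction (trans (m+[n∸m]≡n le) eq) (disjoint p i′≢i _ j f′ f)

  placement⇒≤best : HasPlacement I → n I ≤ best cs (suc (ρ I) ∸ ℓ) 0
  placement⇒≤best = packing⇒≤best cs (tile-starts-filled (isTile I i₀)) _ 0 (n I) ∘ placement⇒packing

  ≤best⇒placement : n I ≤ best cs (suc (ρ I) ∸ ℓ) 0 → HasPlacement I
  ≤best⇒placement n≤ = packing⇒placement (restrict-packing n≤ (best-packing cs _ 0))

-- Program logic

Ends : Program → State → ℕ → (State → Set) → Set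
Ends P σ T Q = ∃ λ t → Σ State λ τ → Run P σ t τ × t ≤ T × Q τ

weaken : ∀ {P σ T U Q} → T ≤ U → Ends P σ T Q → Ends P σ U Q
weaken T≤U (t , τ , run , t≤T , q) = t , τ , run , ≤-trans t≤T T≤U , q

consequence : ∀ {P σ T Q R} → (∀ {τ} → Q τ → R τ) → Ends P σ T Q → Ends P σ T R
consequence f (t , τ , run , t≤T , q) = t , τ , run , t≤T , f q

infixr 5 _then_

_then_ : ∀ {P P′ σ T U Q R} → Ends P σ T Q → (∀ {τ} → Q τ → Ends P′ τ U R) →
         Ends (P ⨾ P′) σ (T + U) R
(t , τ , run , t≤T , q) then next with next q
... | u , υ , run′ , u≤U , r = t + u , υ , run-⨾ run run′ , +-mono-≤ t≤T u≤U , r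

-- The bounds of both branches are added rather than maximised, so that time bounds remain plain
-- sums.
branch : ∀ {r P P′ σ T U Q} → (reg σ r ≢ 0 → Ends P σ T Q) → (reg σ r ≡ 0 → Ends P′ σ U Q) →
         Ends (ifNZ r P P′) σ (suc (T + U)) Q
branch {r} {σ = σ} {T} {U} p q with reg σ r ≟ 0
... | yes z = let t , τ , run , le , post = q z in
  suc t , τ , run-else z run , s≤s (≤-trans le (m≤n+m U T)) , post
... | no nz = let t , τ , run , le , post = p nz in
  suc t , τ , run-then nz run , s≤s (≤-trans le (m≤m+n T U)) , post

-- The invariant is indexed by the rounds left, which the counter register holds; this gives
-- termination and the bound at once. Each round costs its body and one test, and the exit one more
-- test.
countdown : ∀ {r P T} (Inv : ℕ → State → Set) → (∀ {k σ} → Inv k σ → reg σ r ≡ k) →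
            (∀ {k σ} → Inv (suc k) σ → Ends P σ T (Inv k)) →
            ∀ k {σ} → Inv k σ → Ends (whileNZ r P) σ (suc (k * suc T)) (Inv 0)
countdown Inv counter body zero    inv = 1 , _ , run-exit (counter inv) , ≤-refl , inv
countdown {T = T} Inv counter body (suc k) inv
  with body inv
... | t , τ , run , t≤T , inv′ with countdown Inv counter body k inv′
... | u , υ , run′ , u≤U , post =
  suc (t + u) , υ , run-loop (λ z → contradiction (trans (sym (counter inv)) z) λ ()) run run′ ,
  s≤s (subst (t + u ≤_) (+-suc T (k * suc T)) (+-mono-≤ t≤T u≤U)) , post

-- Meant for loop-free code, where it computes to a statement about the final registers and memory;
-- loops are left to `countdown` and get ⊥.
wp : Program → (State → Set) → State → Set
wp skip          Q σ = Q σ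
wp (const r c)   Q σ = Q (setReg σ r c)
wp (add r s s′)  Q σ = Q (setReg σ r (reg σ s + reg σ s′))
wp (sub r s s′)  Q σ = Q (setReg σ r (reg σ s ∸ reg σ s′))
wp (load r s)    Q σ = Q (setReg σ r (mem σ (reg σ s)))
wp (store r s)   Q σ = Q (setMem σ (reg σ r) (reg σ s))
wp (P ⨾ P′)      Q σ = wp P (wp P′ Q) σ
wp (ifNZ r P P′) Q σ = (reg σ r ≢ 0 → wp P Q σ) × (reg σ r ≡ 0 → wp P′ Q σ)
wp (whileNZ r P) Q σ = ⊥

cost : Program → ℕ
cost (P ⨾ P′)      = cost P + cost P′
cost (ifNZ r P P′) = suc (cost P + cost P′)
cost _             = 1

straight : ∀ P {σ Q} → wp P Q σ → Ends P σ (cost P) Q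
straight skip          q         = 1 , _ , run-skip , ≤-refl , q
straight (const r c)   q         = 1 , _ , run-const , ≤-refl , q
straight (add r s s′)  q         = 1 , _ , run-add , ≤-refl , q
straight (sub r s s′)  q         = 1 , _ , run-sub , ≤-refl , q
straight (load r s)    q         = 1 , _ , run-load , ≤-refl , q
straight (store r s)   q         = 1 , _ , run-store , ≤-refl , q
straight (P ⨾ P′)      q         = straight P q then straight P′
straight (ifNZ r P P′) (p , q)   = branch (λ nz → straight P (p nz)) (λ z → straight P′ (q z))

-- The program

-- Registers: 1, 2, 3 hold n, ρ, ℓ; 4 holds 1; 5 and 6 hold 2 ^ ℓ and the mask;
-- 7 is first a read pointer and then the address of the first cell not yet written;
-- 8, 9, 10 hold the addresses of the table of halves, of the table of free windows
-- and of the latest row of best; 11 and 12 are loop counters; 14 accumulates n ℓ;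
-- 15 is the current window; 20 is the address of the row being written.

readHeader countTotal testPacked testEmpty : Program
readHeader =
  -- Register 13 is initially 0, the address of `n`. There is no move instruction: here and below a
  -- register is copied by adding it to a register set to 0.
  const 4 1 ⨾ load 1 13 ⨾ load 2 4 ⨾ add 13 4 4 ⨾ load 3 13 ⨾
  const 14 0 ⨾ const 13 0 ⨾ add 11 13 1
-- Without multiplication, `n ℓ` is formed by `n` additions.
countTotal = add 14 14 3 ⨾ sub 11 11 4
testPacked = sub 13 14 2
testEmpty  = add 12 2 4 ⨾ sub 12 12 3

initMask readMask : Program
-- Cells 0 to 2 hold `n`, `ρ` and the first length, so the symbols of the first tile begin at
-- address 3.
initMask = const 5 1 ⨾ const 6 0 ⨾ const 7 3 ⨾ const 13 0 ⨾ add 11 13 3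
readMask = load 13 7 ⨾ ifNZ 13 (add 6 6 5) skip ⨾ add 5 5 5 ⨾ add 7 7 4 ⨾ sub 11 11 4

-- Each value is stored in two consecutive cells, which tabulates halves without division. The table
-- has twice as many entries as there are windows because it is also consulted at `w + mask`.
initHalves writeHalves : Program
initHalves  = const 13 0 ⨾ add 8 13 7 ⨾ const 15 0 ⨾ add 11 13 5
writeHalves =
  store 7 15 ⨾ add 7 7 4 ⨾ store 7 15 ⨾ add 7 7 4 ⨾ add 15 15 4 ⨾ sub 11 11 4

fetch : Reg → Reg → Reg → Program
fetch r b i = add r b i ⨾ load r r

-- While a window is tested, 13 points to the current symbol, 17 holds the unread part of the
-- window, 18 the flag of `free`, and 19 half of 17.
initFree initScan fetchCell useCell writeFree : Program
initFree  = const 13 0 ⨾ add 9 13 7 ⨾ add 10 13 7 ⨾ const 15 0 ⨾ add 11 13 5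
initScan  = const 13 3 ⨾ const 16 0 ⨾ add 12 16 3 ⨾ add 17 16 15 ⨾ const 18 1
fetchCell = load 16 13 ⨾ fetch 19 8 17
useCell   =
  ifNZ 16 (sub 17 17 19 ⨾ sub 17 17 19 ⨾ sub 18 18 17) skip ⨾
  const 16 0 ⨾ add 17 16 19 ⨾ add 13 13 4 ⨾ sub 12 12 4
writeFree = store 7 18 ⨾ add 7 7 4 ⨾ add 15 15 4 ⨾ sub 11 11 4

initRow placeTile writeBest computeBest endRow : Program
initRow = const 15 0 ⨾ const 13 0 ⨾ add 12 13 5 ⨾ add 20 13 7
placeTile =
  (add 18 15 6 ⨾ fetch 18 8 18) ⨾ fetch 18 10 18 ⨾
  (add 18 18 4 ⨾ sub 18 18 16 ⨾ add 16 16 18)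
writeBest = store 7 16 ⨾ add 7 7 4 ⨾ add 15 15 4 ⨾ sub 12 12 4
computeBest =
  fetch 16 8 15 ⨾ fetch 16 10 16 ⨾ fetch 17 9 15 ⨾ ifNZ 17 placeTile skip ⨾ writeBest
endRow = const 13 0 ⨾ add 10 13 20 ⨾ sub 11 11 4

answer : Program
answer = load 16 10 ⨾ sub 16 1 16 ⨾ sub 0 4 16

-- The table of free windows is also the row best 1, from which the rows start.

search : Program
search =
  initMask ⨾ whileNZ 11 readMask ⨾
  initHalves ⨾ whileNZ 11 writeHalves ⨾
  initFree ⨾ whileNZ 11 (initScan ⨾ whileNZ 12 (fetchCell ⨾ useCell) ⨾ writeFree) ⨾
  -- There are `ρ ∸ ℓ + 1` starting points; row 1 exists already, so `ρ ∸ ℓ` rows remain.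
  sub 11 2 3 ⨾
  whileNZ 11 (initRow ⨾ whileNZ 12 computeBest ⨾ endRow) ⨾
  answer

-- The first test ensures that `search` runs only for `ρ` below `n ℓ`, which bounds its number of
-- rows although `ρ` is given in binary. The second one excludes `ρ < ℓ`, where truncation would
-- make `suc (ρ ∸ ℓ)` differ from `suc ρ ∸ ℓ`.
decide : Program
decide =
  readHeader ⨾ whileNZ 11 countTotal ⨾ testPacked ⨾
  ifNZ 13 (testEmpty ⨾ ifNZ 12 search (const 0 0)) (const 0 1)

-- Tables in memory

increment : ∀ {x a o} → x ≡ a → o ≡ 1 → x + o ≡ suc a
increment {a = a} refl refl = +-comm a 1

decrement : ∀ {x a o} → x ≡ suc a → o ≡ 1 → x ∸ o ≡ a
decrement refl refl = refl

record Table (m : ℕ → ℕ) (b len : ℕ) (f : ℕ → ℕ) : Set where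
  constructor table
  field at : ∀ i → i < len → m (b + i) ≡ f i

open Table

update-same : ∀ m {a v} → (m [ a ↦ v ]) a ≡ v
update-same m {a} {v} =
  cong (λ b → if b then v else m a) (dec-true (a ≟ a) refl)

update-other : ∀ m {a v x} → x ≢ a → (m [ a ↦ v ]) x ≡ m x
update-other m {a} {v} {x} x≢a =
  cong (λ b → if b then v else m x) (dec-false (x ≟ a) x≢a)

table-keep : ∀ {m b len f a v} → b + len ≤ a → Table m b len f → Table (m [ a ↦ v ]) b len f
table-keep {m} {b} le t .at i i<len =
  trans (update-other m (<⇒≢ (<-≤-trans (+-monoʳ-< b i<len) le))) (at t i i<len)

table-extend : ∀ {m b len f a v} → a ≡ b + len → v ≡ f len →
               Table m b len f → Table (m [ a ↦ v ]) b (suc len) f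
table-extend {m} refl refl t .at i i≤len with m<1+n⇒m<n∨m≡n i≤len
... | inj₁ i<len = at (table-keep ≤-refl t) i i<len
... | inj₂ refl  = update-same m

table-resize : ∀ {m b len len′ f} → len ≡ len′ → Table m b len f → Table m b len′ f
table-resize refl t = t

table-head : ∀ {m b len f} → Table m b (suc len) f → m b ≡ f 0
table-head {m} {b} t = trans (cong m (sym (+-identityʳ b))) (at t 0 (s≤s z≤n))

table-tail : ∀ {m b b′ len f} → b′ ≡ suc b → Table m b (suc len) f →
             Table m b′ len (λ i → f (suc i))
table-tail {m} {b} refl t .at i i<len =
  trans (cong m (sym (+-suc b i))) (at t (suc i) (s≤s i<len))

table-at : ∀ {m b len f x y i} → x ≡ b → y ≡ i → i < len → Table m b len f → m (x + y) ≡ f i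
table-at refl refl i<len t = at t _ i<len

-- Loop invariants and correctness of the search

module _ (n ρ : ℕ) (cs : List ℕ) where

  -- `P` is the number of windows; `H` and `F` are the addresses of the tables of halves and of free
  -- windows. The tables start right behind the first tile.
  ℓ P M H F : ℕ
  ℓ = length cs
  P = 2 ^ ℓ
  M = mask cs
  H = 3 + ℓ
  F = H + (P + P)

  Header : State → Set
  Header σ = reg σ 1 ≡ n × reg σ 2 ≡ ρ × reg σ 3 ≡ ℓ × reg σ 4 ≡ 1 ×
             Table (mem σ) 3 ℓ (cell cs)

  Counting : ℕ → State → Set
  Counting k σ = reg σ 11 ≡ k × reg σ 14 + k * ℓ ≡ n * ℓ × Header σ

  count-total : ∀ {k σ} → Counting (suc k) σ → Ends countTotal σ (cost countTotal) (Counting k)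
  count-total {k} {σ} (c , total , h@(_ , _ , l , o , _)) = straight countTotal
    (decrement c o , trans (cong (λ x → reg σ 14 + x + k * ℓ) l)
                       (trans (+-assoc (reg σ 14) ℓ (k * ℓ)) total) , h)

  -- `ds` lists the symbols still to be read: their mask, weighted by the power of two in register
  -- 5, is what register 6 still lacks.
  Reading : ℕ → State → Set
  Reading k σ = reg σ 11 ≡ k × reg σ 7 + k ≡ H × reg σ 5 * 2 ^ k ≡ P ×
    (Σ (List ℕ) λ ds → length ds ≡ k × Table (mem σ) (reg σ 7) k (cell ds) ×
                       reg σ 6 + reg σ 5 * mask ds ≡ M) ×
    Header σ

  read-mask : ∀ {k σ} → Reading (suc k) σ → Ends readMask σ (cost readMask) (Reading k)
  read-mask {k} {σ} (c , ptr , pow , (d ∷ ds , len , t , acc) , h@(_ , _ , _ , o , _)) =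
    straight readMask
      ( (λ nz → c′ , ptr′ , pow′ , (ds , len′ , t′ , one d (subst (_≢ 0) (table-head t) nz) acc) , h)
      , (λ z → c′ , ptr′ , pow′ , (ds , len′ , t′ , zero-code d (trans (sym (table-head t)) z) acc) , h))
    where
    p = reg σ 5
    m = reg σ 6
    c′ = decrement c o
    ptr′ = trans (cong (λ x → reg σ 7 + x + k) o)
             (trans (+-assoc (reg σ 7) 1 k) ptr)
    len′ = suc-injective len
    t′ = table-tail (increment refl o) t
    double : ∀ x → p * (x + x) ≡ (p + p) * x
    double x = trans (*-distribˡ-+ p x x) (sym (*-distribʳ-+ x p p))
    pow′ = trans (sym (double (2 ^ k))) (trans (cong (p *_) (sym (2^suc k))) pow)
    one : ∀ d → d ≢ 0 → m + p * mask (d ∷ ds) ≡ M → m + p + (p + p) * mask ds ≡ M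
    one zero    nz _   = contradiction refl nz
    one (suc d) _  acc = trans (cong (m + p +_) (sym (double (mask ds))))
      (trans (+-assoc m p _) (trans (cong (m +_) (sym (*-suc p _))) acc))
    zero-code : ∀ d → d ≡ 0 → m + p * mask (d ∷ ds) ≡ M → m + (p + p) * mask ds ≡ M
    zero-code d refl acc = trans (cong (m +_) (sym (double (mask ds)))) acc

  Masked : State → Set
  Masked σ = reg σ 5 ≡ P × reg σ 6 ≡ M × Header σ

  Halving : ℕ → State → Set
  Halving k σ = reg σ 11 ≡ k × reg σ 8 ≡ H ×
    (∃ λ v → v + k ≡ P × reg σ 15 ≡ v × reg σ 7 ≡ H + (v + v) ×
             Table (mem σ) H (v + v) ⌊_/2⌋) ×
    Masked σ

  half-double : ∀ v → ⌊ v + v /2⌋ ≡ v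
  half-double v = half-+-double 0 v

  half-suc-double : ∀ v → ⌊ suc (v + v) /2⌋ ≡ v
  half-suc-double v = half-+-double 1 v

  write-halves : ∀ {k σ} → Halving (suc k) σ → Ends writeHalves σ (cost writeHalves) (Halving k)
  write-halves {k} {σ} (c , hb , (v , vk , w , a , t) , ep , em , en , er , el , o , tile) =
    straight writeHalves
      ( decrement c o , hb
      , (suc v , trans (sym (+-suc v k)) vk , increment w o
        , trans (increment (increment a o) o) (sym (shape H))
        , table-resize (sym (cong suc (+-suc v v)))
            (table-extend (trans (increment a o) (sym (+-suc H (v + v)))) (trans w (sym (half-suc-double v)))
              (table-extend a (trans w (sym (half-double v))) t)))
      , ep , em , en , er , el , o
      , table-keep (≤-trans H≤ (m≤m+n _ _)) (table-keep H≤ tile))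
    where
    H≤ : 3 + ℓ ≤ reg σ 7
    H≤ = ≤-trans (m≤m+n H (v + v)) (≤-reflexive (sym a))
    shape : ∀ x → x + (suc v + suc v) ≡ suc (suc (x + (v + v)))
    shape x = trans (cong (λ y → x + suc y) (+-suc v v))
      (trans (+-suc x _) (cong suc (+-suc x _)))

  Prepared : State → Set
  Prepared σ = reg σ 8 ≡ H × Table (mem σ) H (P + P) ⌊_/2⌋ × Masked σ

  prepared-keep : ∀ {σ a v} → F ≤ a → Prepared σ → Prepared (setMem σ a v)
  prepared-keep F≤a (hb , ht , ep , em , en , er , el , o , tile) =
    hb , table-keep F≤a ht , ep , em , en , er , el , o ,
    table-keep (≤-trans (m≤m+n H (P + P)) F≤a) tile

  Freeing : ℕ → State → Set
  Freeing k σ = reg σ 11 ≡ k × reg σ 9 ≡ F × reg σ 10 ≡ F ×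
    (∃ λ v → v + k ≡ P × reg σ 15 ≡ v × reg σ 7 ≡ F + v ×
             Table (mem σ) F v (free 1 cs)) ×
    Prepared σ

  -- The scan preserves the value of `free` at the current flag, the unread symbols `ds` and the
  -- unread window; when `ds` is empty this value is the flag itself.
  Scanning : ℕ → ℕ → State → Set
  Scanning k j σ = reg σ 12 ≡ j × reg σ 11 ≡ suc k × reg σ 9 ≡ F × reg σ 10 ≡ F ×
    (∃ λ v → v + suc k ≡ P × reg σ 15 ≡ v × reg σ 7 ≡ F + v ×
             Table (mem σ) F v (free 1 cs) ×
             reg σ 17 < P × Σ (List ℕ) λ ds → length ds ≡ j ×
             Table (mem σ) (reg σ 13) j (cell ds) ×
             free (reg σ 18) ds (reg σ 17) ≡ free 1 cs v) ×
    Prepared σ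

  init-scan : ∀ {k σ} → Freeing (suc k) σ → Ends initScan σ (cost initScan) (Scanning k ℓ)
  init-scan {k} (c , f , r , (v , vk , w , a , t) , pr@(hb , ht , ep , em , en , er , el , o , tile)) =
    straight initScan
      (el , c , f , r , (v , vk , w , a , t
      , subst (_< P) (sym w) (subst (v <_) vk (m<m+n v (s≤s z≤n)))
      , cs , refl , tile , cong (free 1 cs) w) , pr)

  CellFetched : ℕ → ℕ → State → Set
  CellFetched k j σ = reg σ 16 ≡ mem σ (reg σ 13) × reg σ 19 ≡ ⌊ reg σ 17 /2⌋ × Scanning k j σ

  fetch-cell : ∀ {k j σ} → Scanning k j σ → Ends fetchCell σ (cost fetchCell) (CellFetched k j)
  fetch-cell {k} {j} {σ} s@(c , c₁ , f , r , (v , vk , w , a , t , u< , _) , (hb , ht , _)) =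
    straight fetchCell (refl , table-at hb refl (<-≤-trans u< (m≤m+n P P)) ht , s)

  use-cell : ∀ {k j σ} → CellFetched k (suc j) σ → Ends useCell σ (cost useCell) (Scanning k j)
  use-cell {k} {j} {σ} (d≡ , h≡ , c , c₁ , f , r , (v , vk , w , a , t , u< , d ∷ ds , len , seg , ok)
                  , pr@(hb , ht , ep , em , en , er , el , o , tile)) =
    straight useCell
      ( (λ nz → c′ , c₁ , f , r , (v , vk , w , a , t , h<P , ds , suc-injective len , seg′
                , one d (subst (_≢ 0) head nz) ok) , pr)
      , (λ z → c′ , c₁ , f , r , (v , vk , w , a , t , h<P , ds , suc-injective len , seg′
                , zero-code d (trans (sym head) z) ok) , pr))
    where
    u = reg σ 17
    h = reg σ 19
    head : reg σ 16 ≡ d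
    head = trans d≡ (table-head seg)
    c′ = decrement c o
    h<P : h < P
    h<P = subst (_< P) (sym h≡) (half-< (<-≤-trans u< (m≤m+n P P)))
    seg′ = table-tail (increment refl o) seg
    one : ∀ d → d ≢ 0 → free (reg σ 18) (d ∷ ds) u ≡ free 1 cs v →
          free (reg σ 18 ∸ (u ∸ h ∸ h)) ds h ≡ free 1 cs v
    one zero    nz _  = contradiction refl nz
    one (suc d) _  ok rewrite h≡ | odd-by-halving u = ok
    zero-code : ∀ d → d ≡ 0 → free (reg σ 18) (d ∷ ds) u ≡ free 1 cs v →
                free (reg σ 18) ds h ≡ free 1 cs v
    zero-code d refl ok rewrite h≡ = ok

  write-free : ∀ {k σ} → Scanning k 0 σ → Ends writeFree σ (cost writeFree) (Freeing k)
  write-free {k} {σ} (c , c₁ , f , r , (v , vk , w , a , t , u< , [] , len , seg , ok)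
                     , pr@(_ , _ , _ , _ , _ , _ , _ , o , _)) =
    straight writeFree
      ( decrement c₁ o , f , r
      , (suc v , trans (sym (+-suc v k)) vk , increment w o
        , trans (increment a o) (sym (+-suc F v)) , table-extend a ok t)
      , prepared-keep {σ} (≤-trans (m≤m+n F v) (≤-reflexive (sym a))) pr)

  -- `A` is the address of the latest finished row; the next one is written at `A + P`. With
  -- `F ≤ A`, these writes leave all tables still in use intact.
  Row : ℕ → ℕ → State → Set
  Row A r σ = reg σ 9 ≡ F × reg σ 10 ≡ A × F ≤ A ×
    Table (mem σ) F P (free 1 cs) × Table (mem σ) A P (best cs r) × Prepared σ

  Column : ℕ → ℕ → ℕ → ℕ → ℕ → State → Set
  Column k′ A r v k σ = reg σ 12 ≡ k × reg σ 11 ≡ suc k′ × reg σ 15 ≡ v × v + k ≡ P ×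
    reg σ 20 ≡ A + P × reg σ 7 ≡ A + P + v × Table (mem σ) (A + P) v (best cs (suc r)) ×
    Row A r σ

  Rows : ℕ → ℕ → State → Set
  Rows K k σ = reg σ 11 ≡ k × ∃ λ A → reg σ 7 ≡ A + P × ∃ λ r → r + k ≡ K × Row A r σ

  -- The loop body is cut after each table look-up; the intermediate assertions record the value
  -- fetched, once its index is known to lie inside the table.
  compute-best : ∀ {k′ A r v k σ} → Column k′ A r v (suc k) σ →
                 Ends computeBest σ (cost computeBest) (Column k′ A r (suc v) k)
  compute-best {k′} {A} {r} {v} {k} {σ} col@(_ , _ , _ , vk , _) =
    half-fetched col then λ q → previous-fetched q then λ q → free-fetched q then
    λ {τ} q@(f , x , col) → branch {r = 17} {Q = Computed}
      (λ nz → tile-fetched (nz , q) then λ q → tile-row-fetched q then tile-placed)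
      (λ z → straight skip (skipped x f z , col)) then
    λ {τ} (b , col) → straight writeBest (written {τ} b col)
    where
    Col : State → Set
    Col = Column k′ A r v (suc k)
    v<P : v < P
    v<P = subst (v <_) vk (m<m+n v (s≤s z≤n))
    v+M<2P : v + M < P + P
    v+M<2P = +-mono-< v<P (mask-< cs)
    w : ∀ {τ} → Col τ → reg τ 15 ≡ v
    w (_ , _ , w , _) = w
    row : ∀ {τ} → Col τ → Row A r τ
    row (_ , _ , _ , _ , _ , _ , _ , row) = row
    hb : ∀ {τ} → Col τ → reg τ 8 ≡ H
    hb {τ} col = let _ , _ , _ , _ , _ , hb , _ = row {τ} col in hb
    ht : ∀ {τ} → Col τ → Table (mem τ) H (P + P) ⌊_/2⌋
    ht {τ} col = let _ , _ , _ , _ , _ , _ , ht , _ = row {τ} col in ht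
    em : ∀ {τ} → Col τ → reg τ 6 ≡ M
    em {τ} col = let _ , _ , _ , _ , _ , _ , _ , _ , em , _ = row {τ} col in em
    one : ∀ {τ} → Col τ → reg τ 4 ≡ 1
    one {τ} col = let _ , _ , _ , _ , _ , _ , _ , _ , _ , _ , _ , _ , o , _ = row {τ} col in o
    fb : ∀ {τ} → Col τ → reg τ 9 ≡ F
    fb {τ} col = let fb , _ = row {τ} col in fb
    rb : ∀ {τ} → Col τ → reg τ 10 ≡ A
    rb {τ} col = let _ , rb , _ = row {τ} col in rb
    ft : ∀ {τ} → Col τ → Table (mem τ) F P (free 1 cs)
    ft {τ} col = let _ , _ , _ , ft , _ = row {τ} col in ft
    rt : ∀ {τ} → Col τ → Table (mem τ) A P (best cs r)
    rt {τ} col = let _ , _ , _ , _ , rt , _ = row {τ} col in rt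
    placed : ∀ {x y f} → y ≡ suc (best cs r ⌊ v + M /2⌋) → x ≡ best cs r ⌊ v /2⌋ →
             f ≡ free 1 cs v → f ≢ 0 → x + (y ∸ x) ≡ best cs (suc r) v
    placed {f = f} refl refl eq nz rewrite sym eq = help f nz
      where
      help : ∀ {x y} f → f ≢ 0 → x + (suc y ∸ x) ≡ choose f x y
      help zero    nz = contradiction refl nz
      help {x} {y} (suc _) _ = sym (m⊔n≡m+[n∸m] x (suc y))
    skipped : ∀ {x f} → x ≡ best cs r ⌊ v /2⌋ → f ≡ free 1 cs v → f ≡ 0 → x ≡ best cs (suc r) v
    skipped refl eq z rewrite trans (sym eq) z = refl
    written : ∀ {τ} → reg τ 16 ≡ best cs (suc r) v → Col τ →
              wp writeBest (Column k′ A r (suc v) k) τ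
    written {τ} b (c , c₁ , w , vk , nb , a , t , fb , rb , F≤A , ft , rt , pr@(_ , _ , _ , _ , _ , _ , _ , o , _)) =
      decrement c o , c₁ , increment w o , trans (sym (+-suc v k)) vk , nb ,
      trans (increment a o) (sym (+-suc (A + P) v)) , table-extend a b t ,
      fb , rb , F≤A , table-keep (≤-trans (+-monoˡ-≤ P F≤A) A+P≤) ft , table-keep A+P≤ rt ,
      prepared-keep {τ} (≤-trans F≤A (≤-trans (m≤m+n A P) A+P≤)) pr
      where
      A+P≤ : A + P ≤ reg τ 7
      A+P≤ = ≤-trans (m≤m+n (A + P) v) (≤-reflexive (sym a))
    HalfFetched PreviousFetched FreeFetched TileFetched TileRowFetched Computed : State → Set
    HalfFetched τ = reg τ 16 ≡ ⌊ v /2⌋ × Col τ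
    PreviousFetched τ = reg τ 16 ≡ best cs r ⌊ v /2⌋ × Col τ
    FreeFetched τ = reg τ 17 ≡ free 1 cs v × PreviousFetched τ
    TileFetched τ = reg τ 18 ≡ ⌊ v + M /2⌋ × reg τ 17 ≢ 0 × FreeFetched τ
    TileRowFetched τ = reg τ 18 ≡ best cs r ⌊ v + M /2⌋ × reg τ 17 ≢ 0 × FreeFetched τ
    Computed τ = reg τ 16 ≡ best cs (suc r) v × Col τ
    half-fetched : ∀ {τ} → Col τ → Ends (fetch 16 8 15) τ 2 HalfFetched
    half-fetched {τ} col = straight (fetch 16 8 15)
      (table-at (hb {τ} col) (w {τ} col) (<-≤-trans v<P (m≤m+n P P)) (ht {τ} col) , col)
    previous-fetched : ∀ {τ} → HalfFetched τ → Ends (fetch 16 10 16) τ 2 PreviousFetched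
    previous-fetched {τ} (h , col) = straight (fetch 16 10 16)
      (table-at (rb {τ} col) h (half-< (<-≤-trans v<P (m≤m+n P P))) (rt {τ} col) , col)
    free-fetched : ∀ {τ} → PreviousFetched τ → Ends (fetch 17 9 15) τ 2 FreeFetched
    free-fetched {τ} (x , col) = straight (fetch 17 9 15)
      (table-at (fb {τ} col) (w {τ} col) v<P (ft {τ} col) , x , col)
    tile-fetched : ∀ {τ} → reg τ 17 ≢ 0 × FreeFetched τ →
                   Ends (add 18 15 6 ⨾ fetch 18 8 18) τ 3 TileFetched
    tile-fetched {τ} (nz , f , x , col) = straight (add 18 15 6 ⨾ fetch 18 8 18)
      (table-at (hb {τ} col) (cong₂ _+_ (w {τ} col) (em {τ} col)) v+M<2P (ht {τ} col) , nz , f , x , col)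
    tile-row-fetched : ∀ {τ} → TileFetched τ → Ends (fetch 18 10 18) τ 2 TileRowFetched
    tile-row-fetched {τ} (h , nz , f , x , col) = straight (fetch 18 10 18)
      (table-at (rb {τ} col) h (half-< v+M<2P) (rt {τ} col) , nz , f , x , col)
    tile-placed : ∀ {τ} → TileRowFetched τ →
                  Ends (add 18 18 4 ⨾ sub 18 18 16 ⨾ add 16 16 18) τ 3 Computed
    tile-placed {τ} (y , nz , f , x , col) = straight (add 18 18 4 ⨾ sub 18 18 16 ⨾ add 16 16 18)
      (placed (increment y (one {τ} col)) x f nz , col)

  init-mask : ∀ {σ} → Header σ → Ends initMask σ (cost initMask) (Reading ℓ)
  init-mask h@(_ , _ , el , _ , tile) = straight initMask
    (el , refl , *-identityˡ P , (cs , refl , tile , *-identityˡ M) , h)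

  init-halves : ∀ {σ} → Reading 0 σ → Ends initHalves σ (cost initHalves) (Halving P)
  init-halves {σ} (_ , ptr , pow , ([] , _ , _ , acc) , h) = straight initHalves
    ( trans (sym (*-identityʳ _)) pow , a
    , (0 , refl , refl , trans a (sym (+-identityʳ H)) , table λ _ ())
    , trans (sym (*-identityʳ _)) pow
    , trans (sym (trans (cong (reg σ 6 +_) (*-zeroʳ (reg σ 5))) (+-identityʳ _))) acc
    , h)
    where
    a : reg σ 7 ≡ H
    a = trans (sym (+-identityʳ _)) ptr

  init-free : ∀ {σ} → Halving 0 σ → Ends initFree σ (cost initFree) (Freeing P)
  init-free {σ} (_ , hb , (v , vk , _ , a , t) , masked@(ep , _)) = straight initFree
    ( ep , a′ , a′ , (0 , refl , refl , trans a′ (sym (+-identityʳ F)) , table λ _ ())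
    , hb , table-resize (cong₂ _+_ v≡P v≡P) t , masked)
    where
    v≡P : v ≡ P
    v≡P = trans (sym (+-identityʳ v)) vk
    a′ : reg σ 7 ≡ F
    a′ = trans a (cong₂ (λ x y → H + (x + y)) v≡P v≡P)

  -- By `best-1` the table of free windows is already a row, so the rows start with `r = 1` at
  -- address `F`.
  init-rows : ∀ {σ} → Freeing 0 σ → Ends (sub 11 2 3) σ 1 (Rows (suc (ρ ∸ ℓ)) (ρ ∸ ℓ))
  init-rows {σ} (_ , f , r , (v , vk , _ , a , t) , pr@(_ , _ , _ , _ , _ , er , el , _)) =
    straight (sub 11 2 3)
      ( cong₂ _∸_ er el , F , trans a (cong (F +_) v≡P) , 1 , refl
      , f , r , ≤-refl , t′ , table (λ i i<P → trans (at t′ i i<P) (sym (best-1 cs i))) , pr)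
    where
    v≡P : v ≡ P
    v≡P = trans (sym (+-identityʳ v)) vk
    t′ : Table (mem σ) F P (free 1 cs)
    t′ = table-resize v≡P t

  init-row : ∀ {k r A σ} → reg σ 11 ≡ suc k → reg σ 7 ≡ A + P → Row A r σ →
             Ends initRow σ (cost initRow) (Column k A r 0 P)
  init-row {A = A} c a row@(_ , _ , _ , _ , _ , _ , _ , ep , _) = straight initRow
    (ep , c , refl , refl , a , trans a (sym (+-identityʳ (A + P))) , table (λ _ ()) , row)

  end-row : ∀ {K k r A v σ} → r + suc k ≡ K → Column k A r v 0 σ →
            Ends endRow σ (cost endRow) (Rows K k)
  end-row {k = k} {r} {A} {v} rk (_ , c , _ , vk , nb , a , t , fb , _ , F≤A , ft , _ , pr@(_ , _ , _ , _ , _ , _ , _ , o , _)) =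
    straight endRow
      ( decrement c o , A + P , trans a (cong (A + P +_) v≡P)
      , suc r , trans (sym (+-suc r k)) rk
      , fb , nb , ≤-trans F≤A (m≤m+n A P) , ft , table-resize v≡P t , pr)
    where
    v≡P : v ≡ P
    v≡P = trans (sym (+-identityʳ v)) vk

  Answered : ℕ → State → Set
  Answered K τ = (output τ ≡ 1 × n ≤ best cs K 0) ⊎ (output τ ≡ 0 × ¬ n ≤ best cs K 0)

  test-≤ : ∀ b → (1 ∸ (n ∸ b) ≡ 1 × n ≤ b) ⊎ (1 ∸ (n ∸ b) ≡ 0 × ¬ n ≤ b)
  test-≤ b with n ≤? b
  ... | yes n≤b = inj₁ (cong (1 ∸_) (m≤n⇒m∸n≡0 n≤b) , n≤b)
  ... | no  n≰b = inj₂ (m≤n⇒m∸n≡0 (m<n⇒0<n∸m (≰⇒> n≰b)) , n≰b)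

  read-answer : ∀ {K σ} → Rows K 0 σ → Ends answer σ (cost answer) (Answered K)
  read-answer {K} {σ} (_ , A , _ , r , rk , _ , rb , _ , _ , t , (_ , _ , _ , _ , en , _ , _ , o , _)) =
    straight answer (subst (λ x → (x ≡ 1 × n ≤ best cs K 0) ⊎ (x ≡ 0 × ¬ n ≤ best cs K 0))
      (sym out) (test-≤ (best cs K 0)))
    where
    stored : mem σ (reg σ 10) ≡ best cs K 0
    stored = trans (cong (mem σ) (trans rb (sym (+-identityʳ A))))
      (trans (at t 0 (m^n>0 2 ℓ)) (cong (λ x → best cs x 0) (trans (sym (+-identityʳ r)) rk)))
    out : reg σ 4 ∸ (reg σ 1 ∸ mem σ (reg σ 10)) ≡ 1 ∸ (n ∸ best cs K 0)
    out = cong₂ _∸_ o (cong₂ _∸_ en stored)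

  maskTime halvesTime cellTime freeTime rowTime rowsTime searchTime : ℕ
  maskTime   = suc (ℓ * suc (cost readMask))
  halvesTime = suc (P * suc (cost writeHalves))
  cellTime   = cost initScan + (suc (ℓ * suc (cost fetchCell + cost useCell)) + cost writeFree)
  freeTime   = suc (P * suc cellTime)
  rowTime    = cost initRow + (suc (P * suc (cost computeBest)) + cost endRow)
  rowsTime   = suc ((ρ ∸ ℓ) * suc rowTime)
  searchTime = cost initMask + (maskTime + (cost initHalves + (halvesTime +
    (cost initFree + (freeTime + (1 + (rowsTime + cost answer)))))))

  search-correct : ∀ {σ} → Header σ → Ends search σ searchTime (Answered (suc (ρ ∸ ℓ)))
  search-correct h =
    init-mask h then λ q →
    countdown Reading (λ (c , _) → c) read-mask ℓ q then λ q →
    init-halves q then λ q →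
    countdown Halving (λ (c , _) → c) write-halves P q then λ q →
    init-free q then λ q →
    countdown Freeing (λ (c , _) → c) (λ {k} q →
      init-scan q then λ q →
      countdown (Scanning k) (λ (c , _) → c) (λ q → fetch-cell q then use-cell) ℓ q then
      write-free) P q then λ q →
    init-rows q then λ q →
    countdown (Rows (suc (ρ ∸ ℓ))) (λ (c , _) → c) (λ {k} (c , A , a , r , rk , row) →
      init-row {r = r} c a row then λ q →
      -- The index counts only the entries left to compute, so the number `v` of entries written is
      -- carried existentially.
      countdown (λ j τ → ∃ λ v → Column k A r v j τ) (λ (_ , c , _) → c)
        (λ (v , q) → consequence (suc v ,_) (compute-best {r = r} q))
        P (0 , q) then λ (_ , q) →
      end-row {r = r} rk q) (ρ ∸ ℓ) q then
    read-answer

  headTime : ℕ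
  headTime = suc (n * suc (cost countTotal))

-- Step counts and correctness of the whole program

cell-++ : ∀ cs ds i → i < length cs → cell (cs ++ ds) i ≡ cell cs i
cell-++ (c ∷ cs) ds zero    _         = refl
cell-++ (c ∷ cs) ds (suc i) (s≤s i<l) = cell-++ cs ds i i<l

-- A record, so that c and u can be inferred.

infix 4 _≤_·_
infixr 6 _⊕_

record _≤_·_ (t c u : ℕ) : Set where
  constructor bound
  field proof : t ≤ c * u

_⊕_ : ∀ {s t c d u} → s ≤ c · u → t ≤ d · u → s + t ≤ c + d · u
_⊕_ {c = c} {d} {u} (bound p) (bound q) =
  bound (≤-trans (+-mono-≤ p q) (≤-reflexive (sym (*-distribʳ-+ u c d))))

constant : ∀ c {u} → 1 ≤ u → c ≤ c · u
constant c 1≤u = bound (≤-trans (≤-reflexive (sym (*-identityʳ c))) (*-monoʳ-≤ c 1≤u))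

-- The bound `c · u` covers one round with its test; the exit test is paid by `1 ≤ v`, whence
-- `suc c`.
loop : ∀ k {t c u v} → suc t ≤ c · u → k * u ≤ v → 1 ≤ v → suc (k * suc t) ≤ suc c · v
loop k {t} {c} {u} {v} (bound t≤) ku≤v 1≤v = bound (+-mono-≤ 1≤v (begin
  k * suc t    ≤⟨ *-monoʳ-≤ k t≤ ⟩
  k * (c * u)  ≡⟨ *-assoc k c u ⟨
  k * c * u    ≡⟨ cong (_* u) (*-comm k c) ⟩
  c * k * u    ≡⟨ *-assoc c k u ⟩
  c * (k * u)  ≤⟨ *-monoʳ-≤ c ku≤v ⟩
  c * v        ∎))
  where open ≤-Reasoning

module _ (n ρ : ℕ) (cs : List ℕ) (1≤n : 1 ≤ n) (1≤ℓ : 1 ≤ length cs) where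

  private
    L Q X : ℕ
    L = length cs
    Q = 2 ^ L
    X = n * L * Q

    1≤Q : 1 ≤ Q
    1≤Q = m^n>0 2 L

    nL≤X : n * L ≤ X
    nL≤X = ≤-trans (≤-reflexive (sym (*-identityʳ _))) (*-monoʳ-≤ (n * L) 1≤Q)

    1≤nL : 1 ≤ n * L
    1≤nL = *-mono-≤ 1≤n 1≤ℓ

    1≤X : 1 ≤ X
    1≤X = ≤-trans 1≤nL nL≤X

    L*1≤X : L * 1 ≤ X
    L*1≤X = ≤-trans (≤-reflexive (*-comm L 1)) (≤-trans (*-monoˡ-≤ L 1≤n) nL≤X)

    Q*1≤X : Q * 1 ≤ X
    Q*1≤X = ≤-trans (≤-reflexive (*-comm Q 1)) (*-monoˡ-≤ Q 1≤nL)

    Q*L≤X : Q * L ≤ X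
    Q*L≤X = ≤-trans (≤-reflexive (trans (*-comm Q L) (cong (_* Q) (sym (*-identityˡ L)))))
      (*-monoˡ-≤ Q (*-monoˡ-≤ L 1≤n))

    n*1≤X : n * 1 ≤ X
    n*1≤X = ≤-trans (*-monoʳ-≤ n 1≤ℓ) nL≤X

  searchTime-≤ : ρ ≤ n * L → searchTime n ρ cs ≤ 91 · X
  searchTime-≤ ρ≤nL =
    -- The segments contribute 5 + 9 + 4 + 8 + 5 + 25 + 1 + 31 + 3 = 91, each `loop` adding one to
    -- the factor of its body.
    constant 5 1≤X ⊕ loop L (constant 8 ≤-refl) L*1≤X 1≤X ⊕
    constant 4 1≤X ⊕ loop Q (constant 7 ≤-refl) Q*1≤X 1≤X ⊕
    constant 5 1≤X ⊕ loop Q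
      (constant 6 1≤ℓ ⊕ loop L (constant 13 ≤-refl) (≤-reflexive (*-identityʳ L)) 1≤ℓ ⊕ constant 4 1≤ℓ)
      Q*L≤X 1≤X ⊕
    constant 1 1≤X ⊕ loop (ρ ∸ L)
      (constant 5 1≤Q ⊕ loop Q (constant 21 ≤-refl) (≤-reflexive (*-identityʳ Q)) 1≤Q ⊕ constant 3 1≤Q)
      (*-monoˡ-≤ Q (≤-trans (m∸n≤m ρ L) ρ≤nL)) 1≤X ⊕
    constant 3 1≤X

  headTime-≤ : headTime n ρ cs ≤ 4 · X
  headTime-≤ = loop n (constant 3 ≤-refl) n*1≤X 1≤X

  Tested Sized : State → Set
  Tested τ = reg τ 13 ≡ n * L ∸ ρ × Header n ρ cs τ
  Sized  τ = reg τ 12 ≡ suc ρ ∸ L × Header n ρ cs τ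

  test-packed : ∀ {τ} → Counting n ρ cs 0 τ → Ends testPacked τ 1 Tested
  test-packed (_ , total , h@(_ , er , _)) =
    straight testPacked (cong₂ _∸_ (trans (sym (+-identityʳ _)) total) er , h)

  test-empty : ∀ {τ} → Header n ρ cs τ → Ends testEmpty τ 2 Sized
  test-empty h@(_ , er , el , o , _) = straight testEmpty (cong₂ _∸_ (increment er o) el , h)

  search-or-reject : ∀ {τ} → ρ ≤ n * L → Header n ρ cs τ →
    Ends (testEmpty ⨾ ifNZ 12 search (const 0 0)) τ (2 + suc (91 * X + 1))
         (Answered n ρ cs (suc ρ ∸ L))
  search-or-reject ρ≤nL h = test-empty h then λ {τ} (e , h) → branch
    (λ nz → weaken (_≤_·_.proof (searchTime-≤ ρ≤nL))
      (subst (λ K → Ends search τ (searchTime n ρ cs) (Answered n ρ cs K))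
        (sym (+-∸-assoc 1 {ρ} {L} (s≤s⁻¹ (m∸n≢0⇒n<m {suc ρ} {L} (subst (_≢ 0) e nz))))) (search-correct n ρ cs h)))
    -- With no starting point `best` is 0, which is less than `n`.
    (λ z → straight (const 0 0) (inj₂ (refl , λ n≤ → contradiction (≤-trans 1≤n
      (subst (λ K → n ≤ best cs K 0) (trans (sym e) z) n≤)) λ ())))

  decide-correct : ∀ {l} ds → l ≡ L → cell cs 0 ≢ 0 →
                   Ends decide (initial (n ∷ ρ ∷ l ∷ (cs ++ ds))) (110 * X)
                        (Answered n ρ cs (suc ρ ∸ L))
  decide-correct {l} ds l≡ hd = weaken
    -- 110 = 8 + 4 + 5 + 91 + 1 + 1: header, additions, the two tests with their conditionals,
    -- search, and the rejecting and accepting branches.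
    (_≤_·_.proof (constant 8 1≤X ⊕ headTime-≤ ⊕ constant 5 1≤X ⊕
      (bound {91 * X} {91} ≤-refl ⊕ constant 1 1≤X) ⊕ constant 1 1≤X))
    (straight readHeader {initial ws} {Counting n ρ cs n}
      (refl , refl , refl , refl , l≡ , refl , table (cell-++ cs ds)) then λ q →
    countdown (Counting n ρ cs) (λ (c , _) → c) (count-total n ρ cs) n q then λ q →
    test-packed q then λ (t , h) → branch
      (λ nz → search-or-reject (<⇒≤ (m∸n≢0⇒n<m (subst (_≢ 0) t nz))) h)
      (λ z → straight (const 0 1) (inj₁ (refl ,
        packing⇒≤best cs hd (suc ρ ∸ L) 0 n (consecutive cs n (m∸n≡0⇒m≤n (trans (sym t) z)))))))
    where
    ws = n ∷ ρ ∷ l ∷ (cs ++ ds)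

-- Running times and input sizes

length-tile : ∀ {n} {i : Fin n} {X} → IsTile i X → 2 ≤ length X
length-tile (w , _ , refl) = s≤s (≤-trans (m≤n+m 1 (length w)) (≤-reflexive (sym (length-++ w))))

searchSpace : Instance minLength₁ → ℕ
searchSpace x = tileCount x * tileLength x * 2 ^ tileLength x

decides : ∀ x → DecidesWithin decide minLength₁ x (110 * searchSpace x)
decides (I@record { n = suc m } , u) =
  let open OneTileType u
      cs = codes (tile I zero)
      length-cs = trans (length-map encodeSymbol (tile I zero)) (hasLength zero)
      1≤cs = ≤-trans (<⇒≤ (length-tile (isTile I zero)))
               (≤-reflexive (sym (length-map encodeSymbol (tile I zero))))
      t , τ , run , t≤ , ans = decide-correct (n I) (ρ I) cs (s≤s z≤n) 1≤cs
        (concat (tabulate λ i → length (tile I (suc i)) ∷ codes (tile I (suc i))))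
        (sym (length-map encodeSymbol (tile I zero)))
        (tile-starts-filled (isTile I zero))
      K≡ = cong (suc (ρ I) ∸_) length-cs
      ans′ = subst (λ K → Answered (n I) (ρ I) cs K τ) K≡ ans
  in t , τ , run , subst (λ l → t ≤ 110 * (n I * l * 2 ^ l)) length-cs t≤ ,
     map-⊎ (λ (o , le) → o , ≤best⇒placement I u zero le)
           (λ (o , ¬le) → o , ¬le ∘ placement⇒≤best I u zero) ans′

within : ∀ {P X x T U} → T ≤ U → DecidesWithin P X x T → DecidesWithin P X x U
within T≤U (t , τ , run , t≤T , ans) = t , τ , run , ≤-trans t≤T T≤U , ans

2≤tileLength : ∀ x → 2 ≤ tileLength x
2≤tileLength (I@record { n = suc _ } , u) =
  subst (2 ≤_) (OneTileType.hasLength u zero) (length-tile (isTile I zero))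

1≤tileCount : ∀ x → 1 ≤ tileCount x
1≤tileCount (record { n = suc _ } , _) = s≤s z≤n

1≤log : ∀ {l} → 2 ≤ l → 1 ≤ ⌊log₂ l ⌋
1≤log 2≤l = ≤-trans (≤-reflexive (sym (⌊log₂[2^n]⌋≡n 1))) (⌊log₂⌋-mono-≤ 2≤l)

-- Strong induction by halving, which lowers the logarithm by one.
2^log≤ : ∀ n → 1 ≤ n → 2 ^ ⌊log₂ n ⌋ ≤ n
2^log≤ = <-rec _ λ where
  (suc zero) _ _ → ≤-refl
  n@(suc (suc m)) rec _ → let open ≤-Reasoning in begin
    2 ^ ⌊log₂ n ⌋                        ≤⟨ ^-monoʳ-≤ 2 (m≤n+m∸n ⌊log₂ n ⌋ 1) ⟩
    2 * 2 ^ (⌊log₂ n ⌋ ∸ 1)              ≡⟨ cong (λ x → 2 * 2 ^ x) (⌊log₂⌊n/2⌋⌋≡⌊log₂n⌋∸1 n) ⟨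
    2 * 2 ^ ⌊log₂ ⌊ n /2⌋ ⌋              ≤⟨ *-monoʳ-≤ 2 (rec (⌊n/2⌋<n (suc m)) (s≤s z≤n)) ⟩
    2 * ⌊ n /2⌋                          ≡⟨ cong (⌊ n /2⌋ +_) (+-identityʳ ⌊ n /2⌋) ⟩
    ⌊ n /2⌋ + ⌊ n /2⌋                    ≤⟨ m≤n+m _ (odd n) ⟩
    odd n + (⌊ n /2⌋ + ⌊ n /2⌋)          ≡⟨ odd+half n ⟨
    n                                    ∎

digits : List ℕ → ℕ
digits ws = sum (map (λ w → suc ⌊log₂ w ⌋) ws)

length≤digits : ∀ ws → length ws ≤ digits ws
length≤digits []       = z≤n
length≤digits (w ∷ ws) = s≤s (≤-trans (length≤digits ws) (m≤n+m _ ⌊log₂ w ⌋))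

-- Each tile's block begins with the entry for its length, so it occupies at least one cell.
length-blocks : ∀ {n} (h : Fin n → ℕ) (f : Fin n → List ℕ) →
                n ≤ length (concat (tabulate λ i → h i ∷ f i))
length-blocks {zero}  h f = z≤n
length-blocks {suc n} h f = s≤s (begin
  n                                  ≤⟨ length-blocks (h ∘ suc) (f ∘ suc) ⟩
  length rest                        ≤⟨ m≤n+m _ (length (f zero)) ⟩
  length (f zero) + length rest      ≡⟨ length-++ (f zero) ⟨
  length (f zero ++ rest)            ∎)
  where
  open ≤-Reasoning
  rest = concat (tabulate λ i → h (suc i) ∷ f (suc i))

tileCount≤size : ∀ x → tileCount x ≤ size minLength₁ x
tileCount≤size x@(I , _) = ≤-trans
  (≤-trans (length-blocks (length ∘ tile I) (codes ∘ tile I)) (m≤n+m _ 2))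
  (length≤digits (encode minLength₁ x))

tileLength≤size : ∀ x → tileLength x ≤ size minLength₁ x
tileLength≤size x@(I@record { n = suc m } , u) = ≤-trans (begin
  OneTileType.ℓ u                    ≡⟨ OneTileType.hasLength u zero ⟨
  length (tile I zero)               ≡⟨ length-map encodeSymbol (tile I zero) ⟨
  length first                       ≤⟨ m≤m+n _ (length rest) ⟩
  length first + length rest         ≡⟨ length-++ first ⟨
  -- The three cells in front hold `n`, `ρ` and the length of the first tile.
  length (first ++ rest)             ≤⟨ m≤n+m _ 3 ⟩
  length (encode minLength₁ x)       ∎)
  (length≤digits (encode minLength₁ x))
  where
  open ≤-Reasoning
  first = codes (tile I zero)
  rest = concat (tabulate λ i → length (tile I (suc i)) ∷ codes (tile I (suc i)))

searchSpace≤ : ∀ x → searchSpace x ≤ 2 ^ tileLength x * size minLength₁ x ^ 2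
searchSpace≤ x = begin
  tileCount x * tileLength x * 2 ^ tileLength x  ≡⟨ *-comm _ (2 ^ tileLength x) ⟩
  2 ^ tileLength x * (tileCount x * tileLength x)
    ≤⟨ *-monoʳ-≤ (2 ^ tileLength x) (*-mono-≤ (tileCount≤size x) (tileLength≤size x)) ⟩
  2 ^ tileLength x * (s * s)                     ≡⟨ cong (λ y → 2 ^ tileLength x * (s * y)) (*-identityʳ s) ⟨
  2 ^ tileLength x * s ^ 2                       ∎
  where
  open ≤-Reasoning
  s = size minLength₁ x

-- The extra factors are at least 1: there is a tile, and its two end numerals make its length at
-- least 2.
searchSpace≤′ : ∀ x → searchSpace x ≤
  tileCount x ^ 2 * 2 ^ tileLength x * (tileLength x * ⌊log₂ tileLength x ⌋)
searchSpace≤′ x = begin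
  n₁ * l * p                     ≡⟨ *-assoc n₁ l p ⟩
  n₁ * (l * p)                   ≡⟨ cong (n₁ *_) (*-comm l p) ⟩
  n₁ * (p * l)                   ≡⟨ *-assoc n₁ p l ⟨
  n₁ * p * l                     ≤⟨ *-mono-≤ (*-monoˡ-≤ p n≤n²) l≤ ⟩
  n₁ ^ 2 * p * (l * ⌊log₂ l ⌋)   ∎
  where
  open ≤-Reasoning
  n₁ = tileCount x
  l = tileLength x
  p = 2 ^ l
  n≤n² : n₁ ≤ n₁ ^ 2
  n≤n² = ≤-trans (≤-reflexive (sym (*-identityʳ n₁)))
    (*-monoʳ-≤ n₁ (≤-trans (1≤tileCount x) (≤-reflexive (sym (*-identityʳ n₁)))))
  l≤ : l ≤ l * ⌊log₂ l ⌋
  l≤ = ≤-trans (≤-reflexive (sym (*-identityʳ l))) (*-monoʳ-≤ l (1≤log (2≤tileLength x)))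

-- Computing the parameter function; logarithmic tile length

initExponential doubleOnce exponential : Program
-- Register 2 is still 0, the address of the input.
initExponential = const 0 110 ⨾ load 1 2 ⨾ const 3 1
doubleOnce      = add 0 0 0 ⨾ sub 1 1 3
exponential     = initExponential ⨾ whileNZ 1 doubleOnce

exponential-computable : Computable (λ k → 110 * 2 ^ k)
exponential-computable = exponential , λ k →
  let t , τ , run , _ , (_ , _ , post) =
        straight initExponential {initial [ k ]} {Doubling k k} (refl , refl , refl) then
        countdown (Doubling k) (λ (c , _) → c) (double k) k
  in t , τ , run , trans (sym (*-identityʳ _)) post
  where
  Doubling : ℕ → ℕ → State → Set
  Doubling k j σ = reg σ 1 ≡ j × reg σ 3 ≡ 1 × reg σ 0 * 2 ^ j ≡ 110 * 2 ^ k
  double : ∀ k {j σ} → Doubling k (suc j) σ → Ends doubleOnce σ 2 (Doubling k j)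
  double k {j} {σ} (c , o , e) = straight doubleOnce
    ( decrement c o , o
    , trans (*-distribʳ-+ (2 ^ j) (reg σ 0) (reg σ 0))
        (trans (sym (*-distribˡ-+ (reg σ 0) (2 ^ j) (2 ^ j)))
          (trans (cong (reg σ 0 *_) (sym (2^suc j))) e)))

sumBelow : (ℕ → ℕ) → ℕ → ℕ
sumBelow f zero    = 0
sumBelow f (suc n) = f n + sumBelow f n

≤sumBelow : ∀ f {m n} → m < n → f m ≤ sumBelow f n
≤sumBelow f {m} {suc n} m<1+n with m<1+n⇒m<n∨m≡n m<1+n
... | inj₁ m<n  = ≤-trans (≤sumBelow f m<n) (m≤n+m _ (f n))
... | inj₂ refl = m≤m+n (f m) _

-- From `n₀` on, 2 to the power `c * ⌊log₂ n ⌋` is at most `n ^ c`. The finitely many values below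
-- `n₀` are absorbed into `K` as their sum, plus one to keep `K` positive.
2^-polynomial : ∀ {L} → L ∈O[ (λ n → ⌊log₂ n ⌋) ] →
                ∃ λ K → ∃ λ c → ∀ n l → 1 ≤ n → l ≤ L n → 2 ^ l ≤ K * n ^ c
2^-polynomial {L} (c , n₀ , L≤) = suc small , c , λ n l 1≤n l≤ →
  ≤-trans (^-monoʳ-≤ 2 l≤) (bounded n 1≤n)
  where
  open ≤-Reasoning
  small : ℕ
  small = sumBelow (λ n → 2 ^ L n) n₀
  bounded : ∀ n → 1 ≤ n → 2 ^ L n ≤ suc small * n ^ c
  bounded n@(suc _) 1≤n with n <? n₀
  ... | yes n<n₀ = begin
    2 ^ L n            ≤⟨ ≤sumBelow (λ n → 2 ^ L n) n<n₀ ⟩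
    small              ≤⟨ n≤1+n small ⟩
    suc small          ≡⟨ *-identityʳ (suc small) ⟨
    suc small * 1      ≤⟨ *-monoʳ-≤ (suc small) (m^n>0 n c) ⟩
    suc small * n ^ c  ∎
  ... | no n≮n₀ = begin
    2 ^ L n              ≤⟨ ^-monoʳ-≤ 2 (L≤ n (≮⇒≥ n≮n₀)) ⟩
    2 ^ (c * ⌊log₂ n ⌋)  ≡⟨ cong (2 ^_) (*-comm c ⌊log₂ n ⌋) ⟩
    2 ^ (⌊log₂ n ⌋ * c)  ≡⟨ ^-*-assoc 2 ⌊log₂ n ⌋ c ⟨
    (2 ^ ⌊log₂ n ⌋) ^ c  ≤⟨ ^-monoˡ-≤ c (2^log≤ n 1≤n) ⟩
    n ^ c                ≤⟨ m≤m+n (n ^ c) _ ⟩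
    suc small * n ^ c    ∎

theorem7 : SolvableInO minLength₁ (λ x → tileCount x ^ 2 * 2 ^ tileLength x * (tileLength x * ⌊log₂ tileLength x ⌋))
    × FixedParameterTractable minLength₁ tileLength
    × (∀ (L : ℕ → ℕ) → L ∈O[ (λ n → ⌊log₂ n ⌋) ] → PolynomialTime (restrict minLength₁ (λ x → tileLength x ≤ L (tileCount x))))
theorem7 =
    (110 , decide , λ x → within {X = minLength₁} {x} (*-monoʳ-≤ 110 (searchSpace≤′ x)) (decides x))
  -- The bound for fixed-parameter tractability has no separate constant, so 110 belongs to the
  -- function of the parameter.
  , ((λ k → 110 * 2 ^ k) , exponential-computable , 2 , decide , λ x →
      within {X = minLength₁} {x} (≤-trans (*-monoʳ-≤ 110 (searchSpace≤ x))
        (≤-reflexive (sym (*-assoc 110 (2 ^ tileLength x) _)))) (decides x))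
  , λ L L∈O → let K , c , 2^≤ = 2^-polynomial L∈O in
      -- The exponent combines `c` from the bound on 2 to the tile length with 2 from the product of
      -- tile count and tile length.
      c + 2 , 110 * K , decide , λ (x , l≤) →
        within {X = minLength₁} {x} (polynomial x K c (2^≤ _ _ (1≤tileCount x) l≤)) (decides x)
  where
  polynomial : ∀ x K c → 2 ^ tileLength x ≤ K * tileCount x ^ c →
               110 * searchSpace x ≤ 110 * K * size minLength₁ x ^ (c + 2)
  polynomial x K c 2^≤ = begin
    110 * searchSpace x                    ≤⟨ *-monoʳ-≤ 110 (searchSpace≤ x) ⟩
    110 * (2 ^ tileLength x * s ^ 2)       ≤⟨ *-monoʳ-≤ 110 (*-monoˡ-≤ (s ^ 2) (≤-trans 2^≤
                                                (*-monoʳ-≤ K (^-monoˡ-≤ c (tileCount≤size x))))) ⟩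
    110 * (K * s ^ c * s ^ 2)              ≡⟨ cong (110 *_) (*-assoc K (s ^ c) (s ^ 2)) ⟩
    110 * (K * (s ^ c * s ^ 2))            ≡⟨ cong (λ y → 110 * (K * y)) (^-distribˡ-+-* s c 2) ⟨
    110 * (K * s ^ (c + 2))                ≡⟨ *-assoc 110 K _ ⟨
    110 * K * s ^ (c + 2)                  ∎
    where
    open ≤-Reasoning
    s = size minLength₁ x
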